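{- For all integers $n\ge 0$: (a) $p_{R,D}^{(3,3)}(4n+2)\equiv 0 \pmod 2$; (b) $p_{R,D}^{(2,5)}(4n+3)\equiv 0 \pmod 2$; (c) $\sum_{n=0}^\infty p_{R,D}^{(2,5)}(4n+1)\,q^n\equiv \prod_{m=1}^\infty(1-q^{5m}) \pmod 2$, meaning that the coefficients of $q^n$ on the two sides are congruent modulo $2$ for every $n$.
   Context: For integers $s,t\ge 2$, $p_{R,D}^{(s,t)}(n)$ denotes the number of partitions of $n$ in which no part is divisible by $s$ and no part appears $t$ or more times. -}

module Defs where

open import Data.Nat using (ℕ; zero; suc; _+_; _*_; _∸_; _≤_; _<_; _≤?_; _<?_)
open import Data.Nat.Divisibility using (_∣_; _∣?_)
import Data.Nat.Properties as ℕP
open import Data.Integer as ℤ using (ℤ; +_)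
open import Data.List using (List; []; _∷_; [_]; _++_; map; concatMap; filter; length; replicate; upTo)
open import Data.List.Relation.Unary.All using (All; all?)
open import Data.Product using (_×_)
open import Relation.Nullary using (¬_)
open import Relation.Nullary.Decidable using (_×-dec_; ¬?)

-- Partitions as non-increasing lists of positive integers.
-- parts k n : all partitions of n whose parts are all ≤ k, listed as
-- non-increasing lists (each partition occurs exactly once).  For the
-- largest allowed part (suc k) we choose its multiplicity j (0 ≤ j ≤ n).
parts : ℕ → ℕ → List (List ℕ)
parts zero zero = [ [] ]
parts zero (suc n) = []
parts (suc k) n =
  concatMap (λ j → map (replicate j (suc k) ++_) (parts k (n ∸ j * suc k)))
            (filter (λ j → j * suc k ≤? n) (upTo (suc n)))

-- All partitions of n (every part of a partition of n is ≤ n).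
partitions : ℕ → List (List ℕ)
partitions n = parts n n

occ : ℕ → List ℕ → ℕ
occ a l = length (filter (λ b → b Data.Nat.≟ a) l)

IsRD : ℕ → ℕ → List ℕ → Set
IsRD s t l = All (λ a → ¬ (s ∣ a)) l × All (λ a → occ a l < t) l

isRD? : (s t : ℕ) (l : List ℕ) → Relation.Nullary.Dec (IsRD s t l)
isRD? s t l = all? (λ a → ¬? (s ∣? a)) l ×-dec all? (λ a → occ a l <? t) l

pRD : ℕ → ℕ → ℕ → ℕ
pRD s t n = length (filter (isRD? s t) (partitions n))

Series : Set
Series = ℕ → ℤ

one : Series
one zero = + 1
one (suc _) = + 0

mul1-q^ : ℕ → Series → Series
mul1-q^ k f n with k ≤? n
... | Relation.Nullary.yes _ = f n ℤ.- f (n ∸ k)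
... | Relation.Nullary.no _ = f n

prod5 : ℕ → Series
prod5 zero = one
prod5 (suc N) = mul1-q^ (5 * suc N) (prod5 N)

-- coefficient of q^n in ∏_{m=1}^∞ (1 - q^{5m}); factors with 5m > n
-- (in particular all m > n) do not affect this coefficient.
euler5Coeff : ℕ → ℤ
euler5Coeff n = prod5 n n

{-# OPTIONS --safe #-}

-- Write f_k = ∏ (1 - q^{km}).  The generating function of pRD s t is f_s f_t / (f_1 f_{st}), and over
-- 𝔽₂ one has f_{2k} = f_k², Euler's f_1 = Σ q^{n(3n±1)/2}, Gauss' f_1³ = ψ(q) = Σ q^{n(n+1)/2}, and,
-- sorting the triangular numbers by their index modulo 3, f_1³ = f_3 + q f_9³.
--
-- A fourth power is a series in q⁴ over 𝔽₂, so multiplying by (f_1 f_9)⁴, respectively (f_1 f_5)⁴, does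
-- not mix exponents of different residues modulo 4.  It turns the generating function of pRD 3 3 into
-- ψ(q³)ψ(q⁹) + q (f_3 f_9³)², and that of pRD 2 5 into f_1⁴ · f_1 ψ(q⁵).  The coefficients of
-- ψ(q³)ψ(q⁹) and of f_1 ψ(q⁵) count solutions of x² + 3y² = 4K and x² + 15y² = 8K in odd numbers.
-- Putting x = ±y ± 2w, respectively x = ±y ± 4w, these become y² ± yw + w² = K and
-- 2y² ± yw + 2w² = K, which are symmetric in y and w, so only the solutions with y = w matter modulo 2:
-- there are none in the exponents 4n + 2 and 4n + 3, and in the exponents 4n + 1 they add up to f_5².
module Submission where

open import Defs
open import Algebra.Bundles using (CommutativeRing)
import Algebra.Solver.Ring as RingSolver
open import Algebra.Solver.Ring.AlmostCommutativeRing using (fromCommutativeRing; _-Raw-AlmostCommutative⟶_)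
open import Data.Bool using (Bool; true; false; not; _∧_; _xor_)
open import Data.Bool.Properties using (xor-∧-commutativeRing; ∧-comm; ∧-idem; ∧-zeroʳ; xor-same; xor-identityʳ; xor-comm; not-involutive; not-distribˡ-xor; not-distribʳ-xor; xor-annihilates-not; T-≡; ¬-not)
open import Data.Empty using (⊥)
import Data.Integer.Divisibility as ℤD
import Data.Integer.Properties as ℤ
open import Data.List using (List; []; _∷_; _++_; map; concatMap; filter; length; replicate; upTo; applyUpTo)
open import Data.List.Properties using (filter-accept; filter-reject; filter-++; length-++)
open import Data.List.Relation.Unary.All as All using (All; []; _∷_)
import Data.List.Relation.Unary.All.Properties as All
open import Data.Maybe using (Maybe; just; nothing)
open import Data.Nat as ℕ using (ℕ; zero; suc; _≤_; _<_; z≤n; s≤s; _≡ᵇ_; _∸_; _≤?_; _<?_; NonZero)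
open import Data.Nat.Divisibility using (_∣_; _∣?_; divides; m∣m*n; ∣m+n∣m⇒∣n; >⇒∤)
import Data.Nat.Properties as ℕ
open import Data.Nat.Tactic.RingSolver using (solve-∀)
open import Data.Product using (_,_; proj₁; proj₂; Σ-syntax; ∃-syntax; _×_)
open import Data.Sum as Sum using (_⊎_; inj₁; inj₂)
open import Function using (_∘_; Equivalence; mk⇔; _⇔_; id)
open import Level using (0ℓ)
open import Relation.Binary using (tri<; tri≈; tri>)
open import Relation.Binary.PropositionalEquality as ≡ using (_≡_; _≢_; _≗_)
open import Relation.Nullary using (Dec; yes; no; does; contradiction; ¬_)
open import Relation.Nullary.Decidable using (_⊎-dec_; _×-dec_; dec-true; dec-false; does-⇔)
open import Relation.Unary using (Pred; Decidable)

-- Sums, and products in rings of characteristic 2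

-- Convergence is replaced by algebra: in a commutative ring of characteristic 2, let the powers of
-- x beyond N vanish. Then finitely many factors make up every product, 1 + x^k has a finite
-- geometric inverse, and x may be replaced by x³, x⁵ or x⁹. Both theta identities have finite
-- forms, true for every x and proved by induction. They are used in 𝔽₂⟦q⟧ modulo q^(N+1), where N
-- is the very exponent whose coefficient is wanted. A fourth power acts on each residue class
-- modulo 4 as multiplication by the series itself. Its constant term is 1, so it can be cancelled
-- afterwards. The delicate point is to match each x, for fixed y, with exactly one w. Write x = 2i
-- + 1 and y = 2t + 1: of |i - t| and i + t + 1 exactly one is odd. For x² + 3y² the odd one is w.
-- For x² + 15y² the even one is 2w, and w is odd because the exponent is. There the exponent M is
-- first tripled, which turns pentagonal numbers into triangular ones.

triangle : ℕ → ℕ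
triangle zero = 0
triangle (suc n) = suc n ℕ.+ triangle n

n≤triangle : ∀ n → n ≤ triangle n
n≤triangle zero = z≤n
n≤triangle (suc n) = ℕ.m≤m+n (suc n) _

-- n(3n + 1)/2 and (n + 1)(3n + 2)/2: together, over n ≥ 0, the generalized pentagonal numbers.
pent⁺ pent⁻ : ℕ → ℕ
pent⁺ n = n ℕ.* n ℕ.+ triangle n
pent⁻ n = suc n ℕ.* suc n ℕ.+ triangle n

2*triangle : ∀ n → 2 ℕ.* triangle n ≡ n ℕ.* suc n
2*triangle zero = ≡.refl
2*triangle (suc n) = ≡.trans (ℕ.*-distribˡ-+ 2 (suc n) (triangle n)) (≡.trans (≡.cong (2 ℕ.* suc n ℕ.+_) (2*triangle n)) (eq n))
  where
  eq : ∀ n → 2 ℕ.* suc n ℕ.+ n ℕ.* suc n ≡ suc n ℕ.* suc (suc n)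
  eq = solve-∀

triangle-3n : ∀ n → triangle (3 ℕ.* n) ≡ 3 ℕ.* pent⁺ n
triangle-3n n = ℕ.*-cancelˡ-≡ _ _ 2 (≡.trans (2*triangle (3 ℕ.* n)) (≡.trans (eq₁ n)
  (≡.trans (≡.cong (λ u → 6 ℕ.* (n ℕ.* n) ℕ.+ 3 ℕ.* u) (≡.sym (2*triangle n))) (eq₂ n (triangle n)))))
  where
  eq₁ : ∀ n → 3 ℕ.* n ℕ.* suc (3 ℕ.* n) ≡ 6 ℕ.* (n ℕ.* n) ℕ.+ 3 ℕ.* (n ℕ.* suc n)
  eq₁ = solve-∀
  eq₂ : ∀ n t → 6 ℕ.* (n ℕ.* n) ℕ.+ 3 ℕ.* (2 ℕ.* t) ≡ 2 ℕ.* (3 ℕ.* (n ℕ.* n ℕ.+ t))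
  eq₂ = solve-∀

triangle-1+3n : ∀ n → triangle (1 ℕ.+ 3 ℕ.* n) ≡ 1 ℕ.+ 9 ℕ.* triangle n
triangle-1+3n n = ℕ.*-cancelˡ-≡ _ _ 2 (≡.trans (2*triangle (1 ℕ.+ 3 ℕ.* n)) (≡.trans (eq₁ n)
  (≡.trans (≡.cong (λ u → 2 ℕ.+ 9 ℕ.* u) (≡.sym (2*triangle n))) (eq₂ (triangle n)))))
  where
  eq₁ : ∀ n → (1 ℕ.+ 3 ℕ.* n) ℕ.* suc (1 ℕ.+ 3 ℕ.* n) ≡ 2 ℕ.+ 9 ℕ.* (n ℕ.* suc n)
  eq₁ = solve-∀
  eq₂ : ∀ t → 2 ℕ.+ 9 ℕ.* (2 ℕ.* t) ≡ 2 ℕ.* (1 ℕ.+ 9 ℕ.* t)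
  eq₂ = solve-∀

triangle-2+3n : ∀ n → triangle (2 ℕ.+ 3 ℕ.* n) ≡ 3 ℕ.* pent⁻ n
triangle-2+3n n = ℕ.*-cancelˡ-≡ _ _ 2 (≡.trans (2*triangle (2 ℕ.+ 3 ℕ.* n)) (≡.trans (eq₁ n)
  (≡.trans (≡.cong (λ u → 6 ℕ.* (suc n ℕ.* suc n) ℕ.+ 3 ℕ.* u) (≡.sym (2*triangle n))) (eq₂ n (triangle n)))))
  where
  eq₁ : ∀ n → (2 ℕ.+ 3 ℕ.* n) ℕ.* suc (2 ℕ.+ 3 ℕ.* n) ≡ 6 ℕ.* (suc n ℕ.* suc n) ℕ.+ 3 ℕ.* (n ℕ.* suc n)
  eq₁ = solve-∀
  eq₂ : ∀ n t → 6 ℕ.* (suc n ℕ.* suc n) ℕ.+ 3 ℕ.* (2 ℕ.* t) ≡ 2 ℕ.* (3 ℕ.* (suc n ℕ.* suc n ℕ.+ t))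
  eq₂ = solve-∀

-- A strict bound on the multiplicity of the part `m`; the value 1 leaves only multiplicity 0 to the
-- multiples of `s`.
multiplicityBound : ℕ → ℕ → ℕ → ℕ
multiplicityBound s t m with s ∣? m
... | yes _ = 1
... | no _ = t

module Sums {c ℓ} (R : CommutativeRing c ℓ) where

  open CommutativeRing R
  open import Relation.Binary.Reasoning.Setoid setoid
  open import Algebra.Properties.CommutativeSemigroup +-commutativeSemigroup using (interchange)

  Σ< : ℕ → (ℕ → Carrier) → Carrier
  Σ< zero F = 0#
  Σ< (suc n) F = Σ< n F + F n

  Σ-cong : ∀ n {F G} → (∀ i → i < n → F i ≈ G i) → Σ< n F ≈ Σ< n G
  Σ-cong zero e = refl
  Σ-cong (suc n) e = +-cong (Σ-cong n (λ i i<n → e i (ℕ.m<n⇒m<1+n i<n))) (e n ℕ.≤-refl)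

  Σ-zero : ∀ n {F} → (∀ i → i < n → F i ≈ 0#) → Σ< n F ≈ 0#
  Σ-zero zero e = refl
  Σ-zero (suc n) e = trans (+-cong (Σ-zero n (λ i i<n → e i (ℕ.m<n⇒m<1+n i<n))) (e n ℕ.≤-refl)) (+-identityˡ 0#)

  Σ-+ : ∀ n F G → Σ< n (λ i → F i + G i) ≈ Σ< n F + Σ< n G
  Σ-+ zero F G = sym (+-identityˡ 0#)
  Σ-+ (suc n) F G = trans (+-congʳ (Σ-+ n F G)) (interchange _ _ _ _)

  Σ-*ˡ : ∀ n a F → a * Σ< n F ≈ Σ< n (λ i → a * F i)
  Σ-*ˡ zero a F = zeroʳ a
  Σ-*ˡ (suc n) a F = trans (distribˡ a _ _) (+-congʳ (Σ-*ˡ n a F))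

  Σ-*ʳ : ∀ n a F → Σ< n F * a ≈ Σ< n (λ i → F i * a)
  Σ-*ʳ zero a F = zeroˡ a
  Σ-*ʳ (suc n) a F = trans (distribʳ a _ _) (+-congʳ (Σ-*ʳ n a F))

  Σ-head : ∀ n F → Σ< (suc n) F ≈ F 0 + Σ< n (λ i → F (suc i))
  Σ-head zero F = +-comm 0# (F 0)
  Σ-head (suc n) F = trans (+-congʳ (Σ-head n F)) (+-assoc _ _ _)

  Σ-truncate : ∀ {m n} F → m ≤ n → (∀ i → m ≤ i → F i ≈ 0#) → Σ< n F ≈ Σ< m F
  Σ-truncate {m} {n} F m≤n e = trans (reflexive (≡.cong (λ k → Σ< k F) (≡.sym (ℕ.m∸n+n≡m m≤n)))) (go (n ℕ.∸ m))
    where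
    go : ∀ d → Σ< (d ℕ.+ m) F ≈ Σ< m F
    go zero = refl
    go (suc d) = trans (+-cong (go d) (e (d ℕ.+ m) (ℕ.m≤n+m m d))) (+-identityʳ _)

  Σ-mod3 : ∀ n F → Σ< (3 ℕ.* n) F ≈ Σ< n (λ i → F (3 ℕ.* i) + F (1 ℕ.+ 3 ℕ.* i) + F (2 ℕ.+ 3 ℕ.* i))
  Σ-mod3 zero F = refl
  Σ-mod3 (suc n) F = begin
    Σ< (3 ℕ.* suc n) F ≡⟨ ≡.cong (λ k → Σ< k F) (ℕ.*-suc 3 n) ⟩
    Σ< (3 ℕ.* n) F + F (3 ℕ.* n) + F (1 ℕ.+ 3 ℕ.* n) + F (2 ℕ.+ 3 ℕ.* n) ≈⟨ +-congʳ (+-assoc _ _ _) ⟩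
    Σ< (3 ℕ.* n) F + (F (3 ℕ.* n) + F (1 ℕ.+ 3 ℕ.* n)) + F (2 ℕ.+ 3 ℕ.* n) ≈⟨ +-assoc _ _ _ ⟩
    Σ< (3 ℕ.* n) F + (F (3 ℕ.* n) + F (1 ℕ.+ 3 ℕ.* n) + F (2 ℕ.+ 3 ℕ.* n)) ≈⟨ +-congʳ (Σ-mod3 n F) ⟩
    Σ< (suc n) (λ i → F (3 ℕ.* i) + F (1 ℕ.+ 3 ℕ.* i) + F (2 ℕ.+ 3 ℕ.* i)) ∎

module Char2 {c ℓ} (R : CommutativeRing c ℓ)
  (1+1≈0 : CommutativeRing._≈_ R (CommutativeRing._+_ R (CommutativeRing.1# R) (CommutativeRing.1# R)) (CommutativeRing.0# R)) where

  open CommutativeRing R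
  open import Relation.Binary.Reasoning.Setoid setoid
  open import Algebra.Properties.Semiring.Exp semiring public
  open import Algebra.Properties.Ring ring using (-0#≈0#)
  open Sums R public

  private
    fromBool : Bool → Carrier
    fromBool true = 1#
    fromBool false = 0#

    -1≈1 : - 1# ≈ 1#
    -1≈1 = begin
      - 1#              ≈⟨ +-identityʳ _ ⟨
      - 1# + 0#         ≈⟨ +-congˡ 1+1≈0 ⟨
      - 1# + (1# + 1#)  ≈⟨ +-assoc _ _ _ ⟨
      (- 1# + 1#) + 1#  ≈⟨ +-congʳ (-‿inverseˡ 1#) ⟩
      0# + 1#           ≈⟨ +-identityˡ 1# ⟩
      1#                ∎

    morphism : CommutativeRing.rawRing xor-∧-commutativeRing -Raw-AlmostCommutative⟶ fromCommutativeRing R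
    morphism = record
      { ⟦_⟧ = fromBool
      ; +-homo = λ { true true → sym 1+1≈0 ; true false → sym (+-identityʳ _) ; false _ → sym (+-identityˡ _) }
      ; *-homo = λ { true _ → sym (*-identityˡ _) ; false _ → sym (zeroˡ _) }
      ; -‿homo = λ { true → sym -1≈1 ; false → sym -0#≈0# }
      ; 0-homo = refl
      ; 1-homo = refl
      }

    fromBool-≟ : ∀ a b → Maybe (fromBool a ≈ fromBool b)
    fromBool-≟ true true = just refl
    fromBool-≟ false false = just refl
    fromBool-≟ _ _ = nothing

  -- Coefficients in 𝔽₂, so that this solver knows x + x ≈ 0.
  open RingSolver (CommutativeRing.rawRing xor-∧-commutativeRing) (fromCommutativeRing R) morphism fromBool-≟ public
    using (solve; _:=_; _:+_; _:*_; con; _:^_)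

  x+x≈0 : ∀ x → x + x ≈ 0#
  x+x≈0 = solve 1 (λ x → x :+ x := con false) refl

  Σ-telescope : ∀ n (B : ℕ → Carrier) → Σ< n (λ i → B i + B (suc i)) ≈ B 0 + B n
  Σ-telescope zero B = sym (x+x≈0 (B 0))
  Σ-telescope (suc n) B = trans (+-congʳ (Σ-telescope n B))
    (solve 3 (λ a b c → (a :+ b) :+ (b :+ c) := a :+ c) refl (B 0) (B n) (B (suc n)))

  private
    factor : Carrier → ℕ → ℕ → Carrier
    factor x s i with s ℕ.≤? i
    ... | yes _ = 1# + x ^ suc i
    ... | no _ = 1#

    factor-≤ : ∀ x {s i} → s ≤ i → factor x s i ≈ 1# + x ^ suc i
    factor-≤ x {s} {i} s≤i with s ℕ.≤? i
    ... | yes _ = refl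
    ... | no s≰i = contradiction s≤i s≰i

    factor-> : ∀ x {s i} → i < s → factor x s i ≈ 1#
    factor-> x {s} {i} i<s with s ℕ.≤? i
    ... | yes s≤i = contradiction i<s (ℕ.≤⇒≯ s≤i)
    ... | no _ = refl

  -- ∏_{s < i ≤ n} (1 + x^i), which is 1 when n ≤ s
  poch : Carrier → ℕ → ℕ → Carrier
  poch x s zero = 1#
  poch x s (suc n) = poch x s n * factor x s n

  poch-suc : ∀ x {s n} → s ≤ n → poch x s (suc n) ≈ poch x s n * (1# + x ^ suc n)
  poch-suc x s≤n = *-congˡ (factor-≤ x s≤n)

  poch-empty : ∀ x {s n} → n ≤ s → poch x s n ≈ 1#
  poch-empty x {n = zero} _ = refl
  poch-empty x {n = suc n} n<s = trans (*-cong (poch-empty x (ℕ.<⇒≤ n<s)) (factor-> x n<s)) (*-identityˡ 1#)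

  poch-head : ∀ x {s n} → s < n → poch x s n ≈ (1# + x ^ suc s) * poch x (suc s) n
  poch-head x {s} {suc n} (s≤s s≤n) with ℕ.m≤n⇒m<n∨m≡n s≤n
  ... | inj₂ ≡.refl = begin
    poch x s (suc s)                           ≈⟨ poch-suc x {s} ℕ.≤-refl ⟩
    poch x s s * (1# + x ^ suc s)              ≈⟨ *-congʳ (poch-empty x {s} ℕ.≤-refl) ⟩
    1# * (1# + x ^ suc s)                      ≈⟨ *-comm _ _ ⟩
    (1# + x ^ suc s) * 1#                      ≈⟨ *-congˡ (poch-empty x {suc s} ℕ.≤-refl) ⟨
    (1# + x ^ suc s) * poch x (suc s) (suc s)  ∎
  ... | inj₁ s<n = begin
    poch x s (suc n)                                            ≈⟨ poch-suc x s≤n ⟩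
    poch x s n * (1# + x ^ suc n)                               ≈⟨ *-congʳ (poch-head x s<n) ⟩
    (1# + x ^ suc s) * poch x (suc s) n * (1# + x ^ suc n)      ≈⟨ *-assoc _ _ _ ⟩
    (1# + x ^ suc s) * (poch x (suc s) n * (1# + x ^ suc n))    ≈⟨ *-congˡ (poch-suc x s<n) ⟨
    (1# + x ^ suc s) * poch x (suc s) (suc n)                   ∎

  -- Pentagonal numbers: a finite form of Euler's theorem

  Θ : Carrier → ℕ → Carrier
  Θ x n = Σ< n (λ s → x ^ pent⁺ s + x ^ pent⁻ s)

  Ψ : Carrier → ℕ → Carrier
  Ψ x n = Σ< n (λ t → x ^ triangle t)

  eulerProd : Carrier → ℕ → Carrier
  eulerProd x zero = 1#
  eulerProd x (suc n) = eulerProd x n * (1# + x ^ suc n)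

  eulerProd-cong : ∀ {x y} → x ≈ y → ∀ n → eulerProd x n ≈ eulerProd y n
  eulerProd-cong x≈y zero = refl
  eulerProd-cong x≈y (suc n) = *-cong (eulerProd-cong x≈y n) (+-congˡ (^-congˡ (suc n) x≈y))

  eulerProd≈poch : ∀ x n → eulerProd x n ≈ poch x 0 n
  eulerProd≈poch x zero = refl
  eulerProd≈poch x (suc n) = trans (*-congʳ (eulerProd≈poch x n)) (sym (poch-suc x {0} {n} z≤n))

  ^-exp : ∀ x {m n} → m ≡ n → x ^ m ≈ x ^ n
  ^-exp x = ^-congʳ x

  private
    pentTerm : Carrier → ℕ → ℕ → Carrier
    pentTerm x n s = poch x s n * x ^ (s ℕ.* n ℕ.+ triangle s)

    -- The telescoping partner of `pentTerm`. Its value at `suc n` is x^`pent⁻ n`, one of the two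
    -- powers by which the right hand side grows with `n`; the other, x^`pent⁺ (suc n)`, is the new
    -- last summand.
    pentTel : Carrier → ℕ → ℕ → Carrier
    pentTel x n zero = 0#
    pentTel x n (suc s) = poch x s n * x ^ (suc s ℕ.* suc n ℕ.+ triangle s)

    -- Modulo 2, (1 + z)wy = w + (1 + y)w + zwy. The factor 1 + y extends p = `poch x (suc s) n` to
    -- `poch x s n`, which produces the two telescoping terms.
    pentTerm-step : ∀ x n s → s ≤ n → pentTerm x (suc n) s ≈ pentTerm x n s + (pentTel x n s + pentTel x n (suc s))
    pentTerm-step x n zero _ = begin
      poch x 0 (suc n) * 1#                                     ≈⟨ *-congʳ (poch-suc x {0} {n} z≤n) ⟩
      poch x 0 n * (1# + x ^ suc n) * 1#                        ≈⟨ solve 2 (λ p y → p :* (con true :+ y) :* con true := p :* con true :+ (con false :+ p :* y)) refl (poch x 0 n) (x ^ suc n) ⟩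
      poch x 0 n * 1# + (0# + poch x 0 n * x ^ suc n)           ≈⟨ +-congˡ (+-congˡ (*-congˡ (^-exp x (eq n)))) ⟩
      poch x 0 n * 1# + (0# + poch x 0 n * x ^ (1 ℕ.* suc n ℕ.+ 0)) ∎
      where
      eq : ∀ n → suc n ≡ 1 ℕ.* suc n ℕ.+ 0
      eq = solve-∀
    pentTerm-step x n (suc s) s<n = begin
      poch x (suc s) (suc n) * x ^ (suc s ℕ.* suc n ℕ.+ triangle (suc s))
        ≈⟨ *-cong (poch-suc x s<n) (split W (suc s) e₁) ⟩
      p * (1# + z) * (w * y)
        ≈⟨ solve 4 (λ p z w y → p :* (con true :+ z) :* (w :* y) := p :* w :+ ((con true :+ y) :* p :* w :+ p :* (z :* (w :* y)))) refl p z w y ⟩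
      p * w + ((1# + y) * p * w + p * (z * (w * y)))
        ≈⟨ +-cong (*-congˡ (^-exp x e₂)) (+-cong (*-congʳ (sym (poch-head x s<n))) (*-congˡ (sym (trans (split (suc n) (W ℕ.+ suc s) e₃) (*-congˡ (^-homo-* x W (suc s))))))) ⟩
      pentTerm x n (suc s) + (pentTel x n (suc s) + pentTel x n (suc (suc s))) ∎
      where
      W = suc s ℕ.* suc n ℕ.+ triangle s
      p = poch x (suc s) n
      z = x ^ suc n
      w = x ^ W
      y = x ^ suc s
      split : ∀ {m} a b → m ≡ a ℕ.+ b → x ^ m ≈ x ^ a * x ^ b
      split a b e = trans (^-exp x e) (^-homo-* x a b)
      e₁ : suc s ℕ.* suc n ℕ.+ triangle (suc s) ≡ W ℕ.+ suc s
      e₁ = lem s n (triangle s)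
        where
        lem : ∀ s n t → suc s ℕ.* suc n ℕ.+ (suc s ℕ.+ t) ≡ suc s ℕ.* suc n ℕ.+ t ℕ.+ suc s
        lem = solve-∀
      e₂ : W ≡ suc s ℕ.* n ℕ.+ triangle (suc s)
      e₂ = lem s n (triangle s)
        where
        lem : ∀ s n t → suc s ℕ.* suc n ℕ.+ t ≡ suc s ℕ.* n ℕ.+ (suc s ℕ.+ t)
        lem = solve-∀
      e₃ : suc (suc s) ℕ.* suc n ℕ.+ triangle (suc s) ≡ suc n ℕ.+ (W ℕ.+ suc s)
      e₃ = lem s n (triangle s)
        where
        lem : ∀ s n t → suc (suc s) ℕ.* suc n ℕ.+ (suc s ℕ.+ t) ≡ suc n ℕ.+ (suc s ℕ.* suc n ℕ.+ t ℕ.+ suc s)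
        lem = solve-∀

  -- Shanks' finite form of Euler's pentagonal number theorem: up to a telescoping difference, the
  -- summands do not depend on n.
  shanks-pentagonal : ∀ x n → Σ< (suc n) (λ s → poch x s n * x ^ (s ℕ.* n ℕ.+ triangle s)) ≈ Θ x n + x ^ pent⁺ n
  shanks-pentagonal x zero = solve 0 (con false :+ con true :* con true := con false :+ con true) refl
  shanks-pentagonal x (suc n) = begin
    Σ< (suc n) (pentTerm x (suc n)) + pentTerm x (suc n) (suc n)
      ≈⟨ +-cong (Σ-cong (suc n) (λ s s≤n → pentTerm-step x n s (ℕ.≤-pred s≤n))) (trans (*-congʳ (poch-empty x {suc n} ℕ.≤-refl)) (*-identityˡ _)) ⟩
    Σ< (suc n) (λ s → pentTerm x n s + (pentTel x n s + pentTel x n (suc s))) + x ^ pent⁺ (suc n)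
      ≈⟨ +-congʳ (Σ-+ (suc n) _ _) ⟩
    Σ< (suc n) (pentTerm x n) + Σ< (suc n) (λ s → pentTel x n s + pentTel x n (suc s)) + x ^ pent⁺ (suc n)
      ≈⟨ +-congʳ (+-cong (shanks-pentagonal x n) (Σ-telescope (suc n) (pentTel x n))) ⟩
    Θ x n + x ^ pent⁺ n + (0# + poch x n n * x ^ pent⁻ n) + x ^ pent⁺ (suc n)
      ≈⟨ +-congʳ (+-congˡ (+-congˡ (*-congʳ (poch-empty x {n} ℕ.≤-refl)))) ⟩
    Θ x n + x ^ pent⁺ n + (0# + 1# * x ^ pent⁻ n) + x ^ pent⁺ (suc n)
      ≈⟨ solve 4 (λ a b c d → a :+ b :+ (con false :+ con true :* c) :+ d := a :+ (b :+ c) :+ d) refl (Θ x n) (x ^ pent⁺ n) (x ^ pent⁻ n) _ ⟩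
    Θ x (suc n) + x ^ pent⁺ (suc n) ∎

  -- Triangular numbers: a finite form of Gauss' theorem

  oddProd : Carrier → ℕ → Carrier
  oddProd x zero = 1#
  oddProd x (suc n) = oddProd x n * (1# + x ^ suc (2 ℕ.* n))

  private
    -- Shanks' summand has factors of odd exponent in its denominator. Multiplied by all of
    -- `oddProd x n` it becomes polynomial and keeps `oddProd x s`; this is also the origin of the
    -- factor 1 + x^(2n+1) in `gaussTerm-step`.
    gaussTerm : Carrier → ℕ → ℕ → Carrier
    gaussTerm x n s = poch (x ^ 2) s n * oddProd x s * x ^ (s ℕ.* suc (2 ℕ.* n))

    gaussTel : Carrier → ℕ → ℕ → Carrier
    gaussTel x n zero = 0#
    gaussTel x n (suc s) = poch (x ^ 2) s n * oddProd x (suc s) * x ^ (suc s ℕ.* suc (2 ℕ.* n))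

    square-^ : ∀ x n → (x ^ 2) ^ n ≈ x ^ (2 ℕ.* n)
    square-^ x n = ^-assocʳ x 2 n

    square-^-suc : ∀ x n → (x ^ 2) ^ suc n ≈ x ^ suc (2 ℕ.* n) * x
    square-^-suc x n = begin
      (x ^ 2) ^ suc n      ≈⟨ square-^ x (suc n) ⟩
      x ^ (2 ℕ.* suc n)    ≈⟨ ^-exp x (ℕ.*-suc 2 n) ⟩
      x * x ^ suc (2 ℕ.* n) ≈⟨ *-comm _ _ ⟩
      x ^ suc (2 ℕ.* n) * x ∎

    gaussTerm-step : ∀ x n s → s < n →
      gaussTerm x (suc n) s ≈ (1# + x ^ suc (2 ℕ.* n)) * gaussTerm x n s + (gaussTel x n s + gaussTel x n (suc s))
    gaussTerm-step x n zero 0<n = begin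
      poch (x ^ 2) 0 (suc n) * 1# * 1#
        ≈⟨ *-congʳ (*-congʳ (trans (poch-suc (x ^ 2) {0} {n} z≤n) (*-congˡ (+-congˡ (square-^-suc x n))))) ⟩
      p * (1# + b * x) * 1# * 1#
        ≈⟨ solve 3 (λ p b x → p :* (con true :+ b :* x) :* con true :* con true :=
             (con true :+ b) :* (p :* con true :* con true) :+ (con false :+ p :* (con true :* (con true :+ x :* con true)) :* b)) refl p b x ⟩
      (1# + b) * (p * 1# * 1#) + (0# + p * (1# * (1# + x * 1#)) * b)
        ≈⟨ +-congˡ (+-congˡ (*-congˡ (^-exp x (≡.sym (ℕ.*-identityˡ (suc (2 ℕ.* n))))))) ⟩
      (1# + b) * (p * 1# * 1#) + (0# + p * (1# * (1# + x * 1#)) * x ^ (1 ℕ.* suc (2 ℕ.* n))) ∎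
      where
      p = poch (x ^ 2) 0 n
      b = x ^ suc (2 ℕ.* n)
    gaussTerm-step x n (suc s) s<n = begin
      poch (x ^ 2) (suc s) (suc n) * o * x ^ (suc s ℕ.* suc (2 ℕ.* suc n))
        ≈⟨ *-cong (*-congʳ (trans (poch-suc (x ^ 2) {suc s} {n} (ℕ.<⇒≤ s<n)) (*-congˡ (+-congˡ (square-^-suc x n)))))
                  (trans (^-exp x (e₁ s n)) (^-homo-* x W (2 ℕ.* suc s))) ⟩
      p * (1# + b * x) * o * (w * a)
        ≈⟨ solve 6 (λ p b x o w a → p :* (con true :+ b :* x) :* o :* (w :* a) :=
             (con true :+ b) :* (p :* o :* w) :+ ((con true :+ a) :* p :* o :* w :+ p :* (o :* (con true :+ x :* a)) :* (b :* w))) refl p b x o w a ⟩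
      (1# + b) * (p * o * w) + ((1# + a) * p * o * w + p * (o * (1# + x * a)) * (b * w))
        ≈⟨ +-congˡ (+-cong (*-congʳ (*-congʳ (trans (*-congʳ (+-congˡ (sym (square-^ x (suc s))))) (sym (poch-head (x ^ 2) (ℕ.<-trans (ℕ.n<1+n s) s<n))))))
                           (*-congˡ (sym (^-homo-* x (suc (2 ℕ.* n)) W)))) ⟩
      (1# + b) * gaussTerm x n (suc s) + (gaussTel x n (suc s) + gaussTel x n (suc (suc s))) ∎
      where
      W = suc s ℕ.* suc (2 ℕ.* n)
      p = poch (x ^ 2) (suc s) n
      o = oddProd x (suc s)
      b = x ^ suc (2 ℕ.* n)
      w = x ^ W
      a = x ^ (2 ℕ.* suc s)
      e₁ : ∀ s n → suc s ℕ.* suc (2 ℕ.* suc n) ≡ suc s ℕ.* suc (2 ℕ.* n) ℕ.+ 2 ℕ.* suc s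
      e₁ = solve-∀

    -- For positive `n` a single factor of `poch` is left. The formula also fits `n = 0`, where 1 +
    -- 1 = 0.
    gaussTel-last : ∀ x n → gaussTel x n n ≈ (1# + x ^ (2 ℕ.* n)) * oddProd x n * x ^ (n ℕ.* suc (2 ℕ.* n))
    gaussTel-last x zero = solve 0 (con false := (con true :+ con true) :* con true :* con true) refl
    gaussTel-last x (suc n) = *-congʳ (*-congʳ (begin
      poch (x ^ 2) n (suc n)                ≈⟨ poch-suc (x ^ 2) {n} {n} ℕ.≤-refl ⟩
      poch (x ^ 2) n n * (1# + (x ^ 2) ^ suc n) ≈⟨ *-cong (poch-empty (x ^ 2) {n} ℕ.≤-refl) (+-congˡ (square-^ x (suc n))) ⟩
      1# * (1# + x ^ (2 ℕ.* suc n))         ≈⟨ *-identityˡ _ ⟩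
      1# + x ^ (2 ℕ.* suc n)                ∎))

    triangle-even : ∀ n → triangle (2 ℕ.* n) ≡ n ℕ.* suc (2 ℕ.* n)
    triangle-even zero = ≡.refl
    triangle-even (suc n) = ≡.trans (≡.cong triangle (ℕ.*-suc 2 n)) (≡.trans (≡.cong (λ k → suc (suc (2 ℕ.* n)) ℕ.+ (suc (2 ℕ.* n) ℕ.+ k)) (triangle-even n)) (eq n))
      where
      eq : ∀ n → suc (suc (2 ℕ.* n)) ℕ.+ (suc (2 ℕ.* n) ℕ.+ n ℕ.* suc (2 ℕ.* n)) ≡ suc n ℕ.* suc (2 ℕ.* suc n)
      eq = solve-∀

  -- Shanks' finite form of Gauss' triangular number theorem, by the same telescoping.
  shanks-gauss : ∀ x n →
    Σ< n (λ s → poch (x ^ 2) s n * oddProd x s * x ^ (s ℕ.* suc (2 ℕ.* n))) ≈ oddProd x n * Ψ x (2 ℕ.* n)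
  shanks-gauss x zero = sym (zeroʳ _)
  shanks-gauss x (suc n) = begin
    Σ< n (gaussTerm x (suc n)) + gaussTerm x (suc n) n
      ≈⟨ +-cong (Σ-cong n (gaussTerm-step x n)) lastTerm ⟩
    Σ< n (λ s → (1# + b) * gaussTerm x n s + (gaussTel x n s + gaussTel x n (suc s))) + (1# + b * x) * o * (w * a)
      ≈⟨ +-congʳ (trans (Σ-+ n _ _) (+-cong (sym (Σ-*ˡ n (1# + b) (gaussTerm x n))) (Σ-telescope n (gaussTel x n)))) ⟩
    (1# + b) * Σ< n (gaussTerm x n) + (0# + gaussTel x n n) + (1# + b * x) * o * (w * a)
      ≈⟨ +-congʳ (+-cong (*-congˡ (shanks-gauss x n)) (+-congˡ (gaussTel-last x n))) ⟩
    (1# + b) * (o * Ψ x (2 ℕ.* n)) + (0# + (1# + a) * o * w) + (1# + b * x) * o * (w * a)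
      ≈⟨ solve 6 (λ x b o P a w → (con true :+ b) :* (o :* P) :+ (con false :+ (con true :+ a) :* o :* w) :+ (con true :+ b :* x) :* o :* (w :* a) :=
           (o :* P) :* (con true :+ b) :+ o :* (w :+ (w :* ((b :* x) :* a)))) refl x b o (Ψ x (2 ℕ.* n)) a w ⟩
    (o * Ψ x (2 ℕ.* n)) * (1# + b) + o * (w + w * ((b * x) * a))
      ≈⟨ +-congˡ (*-congˡ (+-congˡ (*-congˡ bxa))) ⟩
    (o * Ψ x (2 ℕ.* n)) * (1# + b) + o * (w + w * (b * b))
      ≈⟨ solve 4 (λ b o P w → (o :* P) :* (con true :+ b) :+ o :* (w :+ w :* (b :* b)) := o :* (con true :+ b) :* (P :+ w :+ b :* w)) refl b o (Ψ x (2 ℕ.* n)) w ⟩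
    o * (1# + b) * (Ψ x (2 ℕ.* n) + w + b * w)
      ≈⟨ *-congˡ (+-cong (+-congˡ w≈) bw≈) ⟩
    o * (1# + b) * Ψ x (2 ℕ.+ 2 ℕ.* n)
      ≡⟨ ≡.cong (λ k → oddProd x (suc n) * Ψ x k) (ℕ.*-suc 2 n) ⟨
    oddProd x (suc n) * Ψ x (2 ℕ.* suc n) ∎
    where
    o = oddProd x n
    b = x ^ suc (2 ℕ.* n)
    w = x ^ (n ℕ.* suc (2 ℕ.* n))
    a = x ^ (2 ℕ.* n)
    -- x * `a` is `b` by definition of powers.
    bxa : (b * x) * a ≈ b * b
    bxa = *-assoc b x a
    w≈ : w ≈ x ^ triangle (2 ℕ.* n)
    w≈ = ^-exp x (≡.sym (triangle-even n))
    bw≈ : b * w ≈ x ^ triangle (suc (2 ℕ.* n))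
    bw≈ = trans (sym (^-homo-* x (suc (2 ℕ.* n)) _)) (^-exp x (≡.cong (suc (2 ℕ.* n) ℕ.+_) (≡.sym (triangle-even n))))
    lastTerm : gaussTerm x (suc n) n ≈ (1# + b * x) * o * (w * a)
    lastTerm = *-cong
      (*-congʳ (begin
        poch (x ^ 2) n (suc n)                    ≈⟨ poch-suc (x ^ 2) {n} {n} ℕ.≤-refl ⟩
        poch (x ^ 2) n n * (1# + (x ^ 2) ^ suc n) ≈⟨ *-cong (poch-empty (x ^ 2) {n} ℕ.≤-refl) (+-congˡ (square-^-suc x n)) ⟩
        1# * (1# + b * x)                         ≈⟨ *-identityˡ _ ⟩
        1# + b * x                                ∎))
      (trans (^-exp x (eq n)) (^-homo-* x (n ℕ.* suc (2 ℕ.* n)) (2 ℕ.* n)))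
      where
      eq : ∀ n → n ℕ.* suc (2 ℕ.* suc n) ≡ n ℕ.* suc (2 ℕ.* n) ℕ.+ 2 ℕ.* n
      eq = solve-∀

  eulerProd-parity : ∀ x n → eulerProd x (2 ℕ.* n) ≈ oddProd x n * eulerProd (x ^ 2) n
  eulerProd-parity x zero = sym (*-identityˡ 1#)
  eulerProd-parity x (suc n) = begin
    eulerProd x (2 ℕ.* suc n) ≡⟨ ≡.cong (eulerProd x) (ℕ.*-suc 2 n) ⟩
    eulerProd x (2 ℕ.* n) * (1# + b) * (1# + x * b)
      ≈⟨ *-cong (*-congʳ (eulerProd-parity x n)) (+-congˡ (trans (*-comm x b) (sym (square-^-suc x n)))) ⟩
    oddProd x n * eulerProd (x ^ 2) n * (1# + b) * (1# + (x ^ 2) ^ suc n)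
      ≈⟨ solve 4 (λ o e b c → o :* e :* b :* c := o :* b :* (e :* c)) refl (oddProd x n) (eulerProd (x ^ 2) n) (1# + b) (1# + (x ^ 2) ^ suc n) ⟩
    oddProd x (suc n) * eulerProd (x ^ 2) (suc n) ∎
    where b = x ^ suc (2 ℕ.* n)

  eulerProd-square : ∀ x n → eulerProd (x ^ 2) n ≈ eulerProd x n * eulerProd x n
  eulerProd-square x zero = sym (*-identityˡ 1#)
  eulerProd-square x (suc n) = begin
    eulerProd (x ^ 2) n * (1# + (x ^ 2) ^ suc n)
      ≈⟨ *-cong (eulerProd-square x n) (+-congˡ (trans (^-assocʳ x 2 (suc n)) (trans (^-exp x (ℕ.*-comm 2 (suc n))) (sym (^-assocʳ x (suc n) 2))))) ⟩
    e * e * (1# + y ^ 2)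
      ≈⟨ solve 2 (λ e y → e :* e :* (con true :+ y :^ 2) := e :* (con true :+ y) :* (e :* (con true :+ y))) refl e y ⟩
    e * (1# + y) * (e * (1# + y)) ∎
    where
    e = eulerProd x n
    y = x ^ suc n

  Ψ-3n : ∀ x n → Ψ x (3 ℕ.* n) ≈ Θ (x ^ 3) n + x * Ψ (x ^ 9) n
  Ψ-3n x n = begin
    Ψ x (3 ℕ.* n)
      ≈⟨ Σ-mod3 n _ ⟩
    Σ< n (λ i → x ^ triangle (3 ℕ.* i) + x ^ triangle (1 ℕ.+ 3 ℕ.* i) + x ^ triangle (2 ℕ.+ 3 ℕ.* i))
      ≈⟨ Σ-cong n (λ i _ → trans
           (+-cong (+-cong (trans (^-exp x (triangle-3n i)) (sym (^-assocʳ x 3 (pent⁺ i))))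
                           (trans (^-exp x (triangle-1+3n i)) (*-congˡ (sym (^-assocʳ x 9 (triangle i))))))
                   (trans (^-exp x (triangle-2+3n i)) (sym (^-assocʳ x 3 (pent⁻ i)))))
           (solve 3 (λ a b c → a :+ b :+ c := a :+ c :+ b) refl _ _ _)) ⟩
    Σ< n (λ i → (x ^ 3) ^ pent⁺ i + (x ^ 3) ^ pent⁻ i + x * (x ^ 9) ^ triangle i)
      ≈⟨ Σ-+ n _ _ ⟩
    Θ (x ^ 3) n + Σ< n (λ i → x * (x ^ 9) ^ triangle i)
      ≈⟨ +-congˡ (sym (Σ-*ˡ n x _)) ⟩
    Θ (x ^ 3) n + x * Ψ (x ^ 9) n ∎

  -- The generating polynomial of the restricted partitions

  geometric : ∀ y n → (1# + y) * Σ< n (y ^_) ≈ 1# + y ^ n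
  geometric y zero = trans (zeroʳ _) (sym 1+1≈0)
  geometric y (suc n) = begin
    (1# + y) * (Σ< n (y ^_) + y ^ n)               ≈⟨ distribˡ _ _ _ ⟩
    (1# + y) * Σ< n (y ^_) + (1# + y) * y ^ n      ≈⟨ +-congʳ (geometric y n) ⟩
    (1# + y ^ n) + (1# + y) * y ^ n                ≈⟨ solve 2 (λ y z → con true :+ z :+ (con true :+ y) :* z := con true :+ y :* z) refl y (y ^ n) ⟩
    1# + y ^ suc n                                 ∎

  private
    regularFactor multipleFactor : ℕ → Carrier → ℕ → Carrier
    regularFactor s x m with s ∣? m
    ... | yes _ = 1#
    ... | no _ = 1# + x ^ m
    multipleFactor s x m with s ∣? m
    ... | yes _ = 1# + x ^ m
    ... | no _ = 1#

    regular*multiple : ∀ s x m → regularFactor s x m * multipleFactor s x m ≈ 1# + x ^ m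
    regular*multiple s x m with s ∣? m
    ... | yes _ = *-identityˡ _
    ... | no _ = *-identityʳ _

    multipleFactor-∣ : ∀ {s m} x → s ∣ m → multipleFactor s x m ≈ 1# + x ^ m
    multipleFactor-∣ {s} {m} x s∣m with s ∣? m
    ... | yes _ = refl
    ... | no s∤m = contradiction s∣m s∤m

    multipleFactor-∤ : ∀ {s m} x → (s ∣ m → ⊥) → multipleFactor s x m ≈ 1#
    multipleFactor-∤ {s} {m} x s∤m with s ∣? m
    ... | yes s∣m = contradiction s∣m s∤m
    ... | no _ = refl

  regularProd multipleProd : ℕ → Carrier → ℕ → Carrier
  regularProd s x zero = 1#
  regularProd s x (suc n) = regularProd s x n * regularFactor s x (suc n)
  multipleProd s x zero = 1#
  multipleProd s x (suc n) = multipleProd s x n * multipleFactor s x (suc n)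

  regular*multipleProd : ∀ s x n → regularProd s x n * multipleProd s x n ≈ eulerProd x n
  regular*multipleProd s x zero = *-identityˡ 1#
  regular*multipleProd s x (suc n) = begin
    regularProd s x n * r * (multipleProd s x n * m)
      ≈⟨ solve 4 (λ a r b m → a :* r :* (b :* m) := a :* b :* (r :* m)) refl (regularProd s x n) r (multipleProd s x n) m ⟩
    regularProd s x n * multipleProd s x n * (r * m)
      ≈⟨ *-cong (regular*multipleProd s x n) (regular*multiple s x (suc n)) ⟩
    eulerProd x (suc n) ∎
    where
    r = regularFactor s x (suc n)
    m = multipleFactor s x (suc n)

  multipleFactor-vanishing : ∀ s {x m} → x ^ m ≈ 0# → multipleFactor s x m ≈ 1#
  multipleFactor-vanishing s {x} {m} e with s ∣? m
  ... | yes _ = trans (+-congˡ e) (+-identityʳ 1#)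
  ... | no _ = refl

  -- Each block of `suc s` consecutive indices ends in its only multiple of `suc s`; by `skip` the
  -- other `s` indices contribute 1.
  multipleProd-multiple : ∀ s x n → multipleProd (suc s) x (n ℕ.* suc s) ≈ eulerProd (x ^ suc s) n
  multipleProd-multiple s x zero = refl
  multipleProd-multiple s x (suc n) = *-cong
    (trans (skip s ℕ.≤-refl) (multipleProd-multiple s x n))
    (trans (multipleFactor-∣ {suc s} {suc n ℕ.* suc s} x (divides (suc n) ≡.refl)) (+-congˡ (trans (^-exp x (ℕ.*-comm (suc n) (suc s))) (sym (^-assocʳ x (suc s) (suc n))))))
    where
    skip : ∀ j → j ≤ s → multipleProd (suc s) x (j ℕ.+ n ℕ.* suc s) ≈ multipleProd (suc s) x (n ℕ.* suc s)
    skip zero _ = refl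
    skip (suc j) j<s = trans (*-cong (skip j (ℕ.<⇒≤ j<s)) (multipleFactor-∤ x ∤)) (*-identityʳ _)
      where
      ∤ : suc s ∣ suc j ℕ.+ n ℕ.* suc s → ⊥
      ∤ d = >⇒∤ (s≤s j<s) (∣m+n∣m⇒∣n (≡.subst (suc s ∣_) (ℕ.+-comm (suc j) _) d) (divides n ≡.refl))

  -- the generating polynomial of the partitions counted by pRD s t with parts ≤ n
  partitionProd : ℕ → ℕ → Carrier → ℕ → Carrier
  partitionProd s t x zero = 1#
  partitionProd s t x (suc n) = partitionProd s t x n * Σ< (multiplicityBound s t (suc n)) ((x ^ suc n) ^_)

  -- For a part m not divisible by `s` this is the geometric sum (1 + x^m)(1 + ... + x^(m(t-1))) = 1
  -- + x^(mt); for multiples of `s` all factors are 1.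
  partitionProd*regularProd : ∀ s t x n → partitionProd s t x n * regularProd s x n ≈ regularProd s (x ^ t) n
  partitionProd*regularProd s t x zero = *-identityˡ 1#
  partitionProd*regularProd s t x (suc n) = begin
    partitionProd s t x n * g * (regularProd s x n * r)
      ≈⟨ solve 4 (λ a g b r → a :* g :* (b :* r) := a :* b :* (r :* g)) refl (partitionProd s t x n) g (regularProd s x n) r ⟩
    partitionProd s t x n * regularProd s x n * (r * g)
      ≈⟨ *-cong (partitionProd*regularProd s t x n) step ⟩
    regularProd s (x ^ t) (suc n) ∎
    where
    g = Σ< (multiplicityBound s t (suc n)) ((x ^ suc n) ^_)
    r = regularFactor s x (suc n)
    step : r * g ≈ regularFactor s (x ^ t) (suc n)
    step with s ∣? suc n
    ... | yes _ = solve 0 (con true :* (con false :+ con true) := con true) refl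
    ... | no _ = trans (geometric (x ^ suc n) t) (+-congˡ (trans (^-assocʳ x (suc n) t) (trans (^-exp x (ℕ.*-comm (suc n) t)) (sym (^-assocʳ x t (suc n))))))

-- Truncated Euler products

module Nilpotent {c ℓ} (R : CommutativeRing c ℓ)
  (1+1≈0 : CommutativeRing._≈_ R (CommutativeRing._+_ R (CommutativeRing.1# R) (CommutativeRing.1# R)) (CommutativeRing.0# R))
  (N : ℕ) where

  open CommutativeRing R
  open import Relation.Binary.Reasoning.Setoid setoid
  open Char2 R 1+1≈0

  -- The substitute for convergence: `q` has this property modulo q^(N+1), and positive powers
  -- inherit it.
  Vanishing : Carrier → Set ℓ
  Vanishing x = ∀ m → N < m → x ^ m ≈ 0#

  vanishing-^ : ∀ {x} → Vanishing x → ∀ k → Vanishing (x ^ suc k)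
  vanishing-^ {x} v k m N<m = trans (^-assocʳ x (suc k) m) (v (suc k ℕ.* m) (ℕ.≤-trans N<m (ℕ.m≤n*m m (suc k))))

  geometric-inverse : ∀ {x} → Vanishing x → (1# + x) * Σ< (suc N) (x ^_) ≈ 1#
  geometric-inverse {x} v = trans (geometric x (suc N)) (trans (+-congˡ (v (suc N) ℕ.≤-refl)) (+-identityʳ 1#))

  eulerProd-unit : ∀ {x} → Vanishing x → ∀ n → Σ[ u ∈ Carrier ] u * eulerProd x n ≈ 1#
  eulerProd-unit v zero = 1# , *-identityˡ 1#
  eulerProd-unit {x} v (suc n) with eulerProd-unit v n
  ... | u , u*e≈1 = u * w , (begin
    u * w * (eulerProd x n * (1# + x ^ suc n))    ≈⟨ solve 4 (λ u w e f → u :* w :* (e :* f) := u :* e :* (f :* w)) refl u w (eulerProd x n) (1# + x ^ suc n) ⟩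
    u * eulerProd x n * ((1# + x ^ suc n) * w)    ≈⟨ *-cong u*e≈1 (geometric-inverse (vanishing-^ v n)) ⟩
    1# * 1#                                       ≈⟨ *-identityˡ 1# ⟩
    1#                                            ∎)
    where w = Σ< (suc N) ((x ^ suc n) ^_)

  eulerProd-cancelˡ : ∀ {x} → Vanishing x → ∀ n {a b} → eulerProd x n * a ≈ eulerProd x n * b → a ≈ b
  eulerProd-cancelˡ {x} v n {a} {b} e with eulerProd-unit v n
  ... | u , u*e≈1 = begin
    a                        ≈⟨ lemma a ⟩
    u * (eulerProd x n * a)  ≈⟨ *-congˡ e ⟩
    u * (eulerProd x n * b)  ≈⟨ lemma b ⟨
    b                        ∎
    where
    lemma : ∀ a → a ≈ u * (eulerProd x n * a)
    lemma a = trans (sym (*-identityˡ a)) (trans (*-congʳ (sym u*e≈1)) (*-assoc _ _ _))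

  eulerProd-stable : ∀ {x} → Vanishing x → ∀ {n} → N ≤ n → eulerProd x n ≈ eulerProd x N
  eulerProd-stable {x} v {n} N≤n = trans (reflexive (≡.cong (eulerProd x) (≡.sym (ℕ.m∸n+n≡m N≤n)))) (go (n ℕ.∸ N))
    where
    go : ∀ d → eulerProd x (d ℕ.+ N) ≈ eulerProd x N
    go zero = refl
    go (suc d) = begin
      eulerProd x (d ℕ.+ N) * (1# + x ^ suc (d ℕ.+ N))  ≈⟨ *-cong (go d) (+-congˡ (v _ (s≤s (ℕ.m≤n+m N d)))) ⟩
      eulerProd x N * (1# + 0#)                          ≈⟨ solve 1 (λ e → e :* (con true :+ con false) := e) refl _ ⟩
      eulerProd x N                                      ∎

  multipleProd-stable : ∀ {x} → Vanishing x → ∀ s {n} → N ≤ n → multipleProd s x n ≈ multipleProd s x N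
  multipleProd-stable {x} v s {n} N≤n = trans (reflexive (≡.cong (multipleProd s x) (≡.sym (ℕ.m∸n+n≡m N≤n)))) (go (n ℕ.∸ N))
    where
    go : ∀ d → multipleProd s x (d ℕ.+ N) ≈ multipleProd s x N
    go zero = refl
    go (suc d) = trans (*-cong (go d) (multipleFactor-vanishing s (v _ (s≤s (ℕ.m≤n+m N d))))) (*-identityʳ _)

  -- The first `N` factors of the Euler product in x^(s+1) are the factors at the multiples up to
  -- `N * suc s`; those beyond `N` equal 1.
  regularProd*eulerProd : ∀ {x} → Vanishing x → ∀ s → regularProd (suc s) x N * eulerProd (x ^ suc s) N ≈ eulerProd x N
  regularProd*eulerProd {x} v s = begin
    regularProd (suc s) x N * eulerProd (x ^ suc s) N
      ≈⟨ *-congˡ (trans (sym (multipleProd-multiple s x N)) (multipleProd-stable v (suc s) (ℕ.m≤m*n N (suc s)))) ⟩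
    regularProd (suc s) x N * multipleProd (suc s) x N
      ≈⟨ regular*multipleProd (suc s) x N ⟩
    eulerProd x N ∎

  -- The quotient formula without division: a product over the indices not divisible by s is f_1 /
  -- f_s at x and f_t / f_(st) at x^t, where s and t stand for `suc s` and `suc t`.
  partitionProd*eulerProds : ∀ {x} → Vanishing x → ∀ s t →
    partitionProd (suc s) (suc t) x N * (eulerProd x N * eulerProd ((x ^ suc t) ^ suc s) N)
      ≈ eulerProd (x ^ suc t) N * eulerProd (x ^ suc s) N
  partitionProd*eulerProds {x} v s t = begin
    G * (eulerProd x N * b)  ≈⟨ *-congˡ (*-congʳ (regularProd*eulerProd v s)) ⟨
    G * (r * a * b)          ≈⟨ solve 4 (λ G r a b → G :* (r :* a :* b) := G :* r :* b :* a) refl G r a b ⟩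
    G * r * b * a            ≈⟨ *-congʳ (*-congʳ (partitionProd*regularProd (suc s) (suc t) x N)) ⟩
    regularProd (suc s) (x ^ suc t) N * b * a  ≈⟨ *-congʳ (regularProd*eulerProd (vanishing-^ v t) s) ⟩
    eulerProd (x ^ suc t) N * a  ∎
    where
    G = partitionProd (suc s) (suc t) x N
    r = regularProd (suc s) x N
    a = eulerProd (x ^ suc s) N
    b = eulerProd ((x ^ suc t) ^ suc s) N

  Ψ-stable : ∀ {x} → Vanishing x → ∀ {m n} → N < m → m ≤ n → Ψ x n ≈ Ψ x m
  Ψ-stable v N<m m≤n = Σ-truncate _ m≤n (λ i m≤i → v _ (ℕ.<-≤-trans N<m (ℕ.≤-trans m≤i (n≤triangle i))))

  module _ (1≤N : 1 ≤ N) where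

    private
      N<pent⁺ : ∀ i → N ≤ i → N < pent⁺ i
      N<pent⁺ zero N≤0 = contradiction (ℕ.≤-trans 1≤N N≤0) λ ()
      N<pent⁺ (suc i) N≤i = ℕ.≤-<-trans (ℕ.≤-trans N≤i (ℕ.m≤n*m (suc i) (suc i)))
        (ℕ.m<m+n (suc i ℕ.* suc i) (s≤s z≤n))

      N<pent⁻ : ∀ i → N ≤ i → N < pent⁻ i
      N<pent⁻ i N≤i = ℕ.≤-trans (s≤s N≤i) (ℕ.≤-trans (ℕ.m≤n*m (suc i) (suc i)) (ℕ.m≤m+n _ (triangle i)))

      N<2N : N < 2 ℕ.* N
      N<2N = ℕ.m<m+n N (ℕ.≤-trans 1≤N (ℕ.m≤m+n N 0))

    -- In Shanks' identity for `N` factors, every summand with s > 0 has an exponent beyond `N`, and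
    -- so has x^`pent⁺ N`. Only the product and the theta sum remain.
    euler-pentagonal : ∀ {x} → Vanishing x → ∀ {n} → N ≤ n → eulerProd x N ≈ Θ x n
    euler-pentagonal {x} v {n} N≤n = begin
      eulerProd x N
        ≈⟨ eulerProd≈poch x N ⟩
      poch x 0 N
        ≈⟨ solve 1 (λ p → p := p :* con true :+ con false) refl _ ⟩
      poch x 0 N * 1# + 0#
        ≈⟨ +-congˡ (Σ-zero N (λ s _ → trans (*-congˡ (v _ (N<exponent s))) (zeroʳ _))) ⟨
      poch x 0 N * 1# + Σ< N (λ s → poch x (suc s) N * x ^ (suc s ℕ.* N ℕ.+ triangle (suc s)))
        ≈⟨ Σ-head N _ ⟨
      Σ< (suc N) (λ s → poch x s N * x ^ (s ℕ.* N ℕ.+ triangle s))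
        ≈⟨ shanks-pentagonal x N ⟩
      Θ x N + x ^ pent⁺ N
        ≈⟨ +-congˡ (v _ (N<pent⁺ N ℕ.≤-refl)) ⟩
      Θ x N + 0#
        ≈⟨ +-identityʳ _ ⟩
      Θ x N
        ≈⟨ Σ-truncate _ N≤n (λ i N≤i → trans (+-cong (v _ (N<pent⁺ i N≤i)) (v _ (N<pent⁻ i N≤i))) (+-identityʳ 0#)) ⟨
      Θ x n ∎
      where
      N<exponent : ∀ s → N < suc s ℕ.* N ℕ.+ triangle (suc s)
      N<exponent s = ℕ.≤-<-trans (ℕ.m≤n*m N (suc s)) (ℕ.m<m+n (suc s ℕ.* N) (s≤s z≤n))

    -- Modulo 2, Gauss' product for the triangular numbers is the cube of Euler's.
    euler-cube : ∀ {x} → Vanishing x → ∀ {n} → 2 ℕ.* N ≤ n →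
      eulerProd x N * (eulerProd x N * eulerProd x N) ≈ Ψ x n
    -- Gauss' theorem reads e² = oψ here. Sorting the factors by parity gives o e² = e, hence e⁴ = o
    -- e² ψ = eψ, and e cancels.
    euler-cube {x} v {n} 2N≤n = eulerProd-cancelˡ v N (begin
      e * (e * (e * e))
        ≈⟨ solve 1 (λ e → e :* (e :* (e :* e)) := (e :* e) :* (e :* e)) refl e ⟩
      (e * e) * (e * e)
        ≈⟨ *-congˡ gauss ⟩
      (e * e) * (o * Ψ x (2 ℕ.* N))
        ≈⟨ solve 3 (λ e o p → (e :* e) :* (o :* p) := o :* (e :* e) :* p) refl e o _ ⟩
      o * (e * e) * Ψ x (2 ℕ.* N)
        ≈⟨ *-congʳ (*-congˡ (sym (eulerProd-square x N))) ⟩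
      o * eulerProd (x ^ 2) N * Ψ x (2 ℕ.* N)
        ≈⟨ *-cong (trans (sym (eulerProd-parity x N)) (eulerProd-stable v (ℕ.<⇒≤ N<2N))) (sym (Ψ-stable v N<2N 2N≤n)) ⟩
      e * Ψ x n ∎)
      where
      e = eulerProd x N
      o = oddProd x N
      term : ℕ → Carrier
      term s = poch (x ^ 2) s N * oddProd x s * x ^ (s ℕ.* suc (2 ℕ.* N))
      firstTerm : Σ< N term ≈ poch (x ^ 2) 0 N * 1# * 1#
      firstTerm = trans (Σ-truncate term 1≤N (λ { (suc i) _ → trans (*-congˡ (v _ (ℕ.<-trans N<2N (ℕ.m≤n*m (suc (2 ℕ.* N)) (suc i))))) (zeroʳ _) })) (+-identityˡ _)
      gauss : e * e ≈ o * Ψ x (2 ℕ.* N)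
      gauss = begin
        e * e                       ≈⟨ eulerProd-square x N ⟨
        eulerProd (x ^ 2) N         ≈⟨ eulerProd≈poch (x ^ 2) N ⟩
        poch (x ^ 2) 0 N            ≈⟨ solve 1 (λ p → p := p :* con true :* con true) refl _ ⟩
        poch (x ^ 2) 0 N * 1# * 1#  ≈⟨ firstTerm ⟨
        Σ< N term                   ≈⟨ shanks-gauss x N ⟩
        o * Ψ x (2 ℕ.* N)           ∎

    cube-3-dissection : ∀ {x} → Vanishing x →
      eulerProd x N * (eulerProd x N * eulerProd x N)
        ≈ eulerProd (x ^ 3) N + x * (eulerProd (x ^ 9) N * (eulerProd (x ^ 9) N * eulerProd (x ^ 9) N))
    cube-3-dissection {x} v = begin
      eulerProd x N * (eulerProd x N * eulerProd x N)
        ≈⟨ euler-cube v (ℕ.m≤n*m (2 ℕ.* N) 3) ⟩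
      Ψ x (3 ℕ.* (2 ℕ.* N))
        ≈⟨ Ψ-3n x (2 ℕ.* N) ⟩
      Θ (x ^ 3) (2 ℕ.* N) + x * Ψ (x ^ 9) (2 ℕ.* N)
        ≈⟨ +-cong (euler-pentagonal (vanishing-^ v 2) (ℕ.<⇒≤ N<2N)) (*-congˡ (euler-cube (vanishing-^ v 8) ℕ.≤-refl)) ⟨
      eulerProd (x ^ 3) N + x * (eulerProd (x ^ 9) N * (eulerProd (x ^ 9) N * eulerProd (x ^ 9) N)) ∎

    -- Which `g` occurs is left open because only the shape g²x matters: at x = q it has odd
    -- exponents only.
    partitionProd-3-3 : ∀ {x} → Vanishing x → ∀ {b} → 2 ℕ.* N ≤ b → let f = eulerProd x N * eulerProd (x ^ 9) N in
      Σ[ g ∈ Carrier ] f * f * (f * f) * partitionProd 3 3 x N ≈ g * g * x + Ψ (x ^ 3) b * Ψ (x ^ 9) b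
    partitionProd-3-3 {x} v {b} 2N≤b = e₃ * e₉³ , (begin
      e₁ * e₉ * (e₁ * e₉) * (e₁ * e₉ * (e₁ * e₉)) * G
        ≈⟨ solve 3 (λ e₁ e₉ G → e₁ :* e₉ :* (e₁ :* e₉) :* (e₁ :* e₉ :* (e₁ :* e₉)) :* G
             := e₁ :* (e₁ :* e₁) :* (e₉ :* (e₉ :* e₉)) :* (G :* (e₁ :* e₉))) refl e₁ e₉ G ⟩
      e₁ * (e₁ * e₁) * e₉³ * (G * (e₁ * e₉))
        ≈⟨ *-cong (*-congʳ (cube-3-dissection v)) G-identity ⟩
      (e₃ + x * e₉³) * e₉³ * (e₃ * e₃)
        ≈⟨ solve 3 (λ x e₃ c → (e₃ :+ x :* c) :* c :* (e₃ :* e₃) := e₃ :* c :* (e₃ :* c) :* x :+ e₃ :* (e₃ :* e₃) :* c) refl x e₃ e₉³ ⟩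
      e₃ * e₉³ * (e₃ * e₉³) * x + e₃ * (e₃ * e₃) * e₉³
        ≈⟨ +-congˡ (*-cong (euler-cube (vanishing-^ v 2) 2N≤b) (euler-cube (vanishing-^ v 8) 2N≤b)) ⟩
      e₃ * e₉³ * (e₃ * e₉³) * x + Ψ (x ^ 3) b * Ψ (x ^ 9) b ∎)
      where
      G = partitionProd 3 3 x N
      e₁ = eulerProd x N
      e₃ = eulerProd (x ^ 3) N
      e₉ = eulerProd (x ^ 9) N
      e₉³ = e₉ * (e₉ * e₉)
      G-identity : G * (e₁ * e₉) ≈ e₃ * e₃
      G-identity = trans (*-congˡ (*-congˡ (eulerProd-cong (sym (^-assocʳ x 3 3)) N))) (partitionProd*eulerProds v 2 2)

    -- Starts from G f_1 f_10 = f_5 f_2 with f_10 = f_5² and f_2 = f_1². Besides f_1⁴ this leaves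
    -- f_1 f_5³, a pentagonal times a triangular sum.
    partitionProd-2-5 : ∀ {x} → Vanishing x → ∀ {b} → 2 ℕ.* N ≤ b → let f = eulerProd x N * eulerProd (x ^ 5) N in
      f * f * (f * f) * partitionProd 2 5 x N
        ≈ eulerProd x N * eulerProd x N * (eulerProd x N * eulerProd x N) * (Θ x b * Ψ (x ^ 5) b)
    partitionProd-2-5 {x} v {b} 2N≤b = begin
      e₁ * e₅ * (e₁ * e₅) * (e₁ * e₅ * (e₁ * e₅)) * G
        ≈⟨ solve 3 (λ e₁ e₅ G → e₁ :* e₅ :* (e₁ :* e₅) :* (e₁ :* e₅ :* (e₁ :* e₅)) :* G
             := e₁ :* (e₁ :* e₁) :* (e₅ :* e₅) :* (G :* (e₁ :* (e₅ :* e₅)))) refl e₁ e₅ G ⟩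
      e₁ * (e₁ * e₁) * (e₅ * e₅) * (G * (e₁ * (e₅ * e₅)))
        ≈⟨ *-congˡ G-identity ⟩
      e₁ * (e₁ * e₁) * (e₅ * e₅) * (e₅ * (e₁ * e₁))
        ≈⟨ solve 2 (λ e₁ e₅ → e₁ :* (e₁ :* e₁) :* (e₅ :* e₅) :* (e₅ :* (e₁ :* e₁))
             := e₁ :* e₁ :* (e₁ :* e₁) :* (e₁ :* (e₅ :* (e₅ :* e₅)))) refl e₁ e₅ ⟩
      e₁ * e₁ * (e₁ * e₁) * (e₁ * (e₅ * (e₅ * e₅)))
        ≈⟨ *-congˡ (*-cong (euler-pentagonal v (ℕ.≤-trans (ℕ.<⇒≤ N<2N) 2N≤b)) (euler-cube (vanishing-^ v 4) 2N≤b)) ⟩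
      e₁ * e₁ * (e₁ * e₁) * (Θ x b * Ψ (x ^ 5) b) ∎
      where
      G = partitionProd 2 5 x N
      e₁ = eulerProd x N
      e₅ = eulerProd (x ^ 5) N
      G-identity : G * (e₁ * (e₅ * e₅)) ≈ e₅ * (e₁ * e₁)
      G-identity = begin
        G * (e₁ * (e₅ * e₅))                       ≈⟨ *-congˡ (*-congˡ (sym (eulerProd-square (x ^ 5) N))) ⟩
        G * (e₁ * eulerProd ((x ^ 5) ^ 2) N)       ≈⟨ partitionProd*eulerProds v 1 4 ⟩
        e₅ * eulerProd (x ^ 2) N                   ≈⟨ *-congˡ (eulerProd-square x N) ⟩
        e₅ * (e₁ * e₁)                             ∎

    eulerProd-square-pentagonal : ∀ {x} → Vanishing x → ∀ k {n} → N ≤ n →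
      eulerProd (x ^ suc k) N * eulerProd (x ^ suc k) N ≈ Θ (x ^ (suc k ℕ.* 2)) n
    eulerProd-square-pentagonal {x} v k {n} N≤n = begin
      eulerProd (x ^ suc k) N * eulerProd (x ^ suc k) N  ≈⟨ eulerProd-square (x ^ suc k) N ⟨
      eulerProd ((x ^ suc k) ^ 2) N                      ≈⟨ eulerProd-cong (^-assocʳ x (suc k) 2) N ⟩
      eulerProd (x ^ (suc k ℕ.* 2)) N                    ≈⟨ euler-pentagonal (vanishing-^ v (suc (k ℕ.* 2))) N≤n ⟩
      Θ (x ^ (suc k ℕ.* 2)) n                            ∎

-- Power series over 𝔽₂ modulo q^(N+1)

𝔽₂⟦q⟧ : Set
𝔽₂⟦q⟧ = ℕ → Bool

infixl 6 _⊕_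
infixl 7 _⊛_

-- The Cauchy product, by recursion on the degree: the constant term of the left factor is split
-- off, and inductions continue with `f ∘ suc`.
_⊕_ _⊛_ : 𝔽₂⟦q⟧ → 𝔽₂⟦q⟧ → 𝔽₂⟦q⟧
(f ⊕ g) n = f n xor g n
(f ⊛ g) zero = f 0 ∧ g 0
(f ⊛ g) (suc n) = (f 0 ∧ g (suc n)) xor (f ∘ suc ⊛ g) n

𝟘 𝟙 q : 𝔽₂⟦q⟧
𝟘 _ = false
𝟙 zero = true
𝟙 (suc _) = false
q zero = false
q (suc n) = 𝟙 n

module 𝔽₂ = Sums xor-∧-commutativeRing

private
  module B₂ = CommutativeRing xor-∧-commutativeRing
  open Char2 xor-∧-commutativeRing ≡.refl using (solve; _:=_; _:+_; _:*_; con)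

  _∙_ : Bool → 𝔽₂⟦q⟧ → 𝔽₂⟦q⟧
  (b ∙ f) n = b ∧ f n

⊛-cong : ∀ {f f′ g g′} n → (∀ i → i ≤ n → f i ≡ f′ i) → (∀ i → i ≤ n → g i ≡ g′ i) → (f ⊛ g) n ≡ (f′ ⊛ g′) n
⊛-cong zero e₁ e₂ = ≡.cong₂ _∧_ (e₁ 0 z≤n) (e₂ 0 z≤n)
⊛-cong (suc n) e₁ e₂ = ≡.cong₂ _xor_ (≡.cong₂ _∧_ (e₁ 0 z≤n) (e₂ (suc n) ℕ.≤-refl))
  (⊛-cong n (λ i i≤n → e₁ (suc i) (s≤s i≤n)) (λ i i≤n → e₂ i (ℕ.m≤n⇒m≤1+n i≤n)))

⊛-congʳ : ∀ g {f f′} → f ≗ f′ → f ⊛ g ≗ f′ ⊛ g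
⊛-congʳ g e n = ⊛-cong n (λ i _ → e i) (λ _ _ → ≡.refl)

⊛-distribʳ : ∀ f g h → (f ⊕ g) ⊛ h ≗ f ⊛ h ⊕ g ⊛ h
⊛-distribʳ f g h zero = solve 3 (λ a b c → (a :+ b) :* c := a :* c :+ b :* c) ≡.refl (f 0) (g 0) (h 0)
⊛-distribʳ f g h (suc n) = ≡.trans
  (≡.cong (((f 0 xor g 0) ∧ h (suc n)) xor_) (⊛-distribʳ (f ∘ suc) (g ∘ suc) h n))
  (solve 5 (λ a b c u v → (a :+ b) :* c :+ (u :+ v) := a :* c :+ u :+ (b :* c :+ v)) ≡.refl (f 0) (g 0) (h (suc n)) _ _)

∙-⊛ : ∀ b f g → (b ∙ f) ⊛ g ≗ b ∙ (f ⊛ g)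
∙-⊛ b f g zero = solve 3 (λ b x y → b :* x :* y := b :* (x :* y)) ≡.refl b (f 0) (g 0)
∙-⊛ b f g (suc n) = ≡.trans (≡.cong (((b ∧ f 0) ∧ g (suc n)) xor_) (∙-⊛ b (f ∘ suc) g n))
  (solve 4 (λ b x y z → b :* x :* y :+ b :* z := b :* (x :* y :+ z)) ≡.refl b (f 0) (g (suc n)) _)

⊛-zeroˡ : ∀ f → 𝟘 ⊛ f ≗ 𝟘
⊛-zeroˡ f zero = ≡.refl
⊛-zeroˡ f (suc n) = ⊛-zeroˡ f n

⊛-identityˡ : ∀ f → 𝟙 ⊛ f ≗ f
⊛-identityˡ f zero = ≡.refl
⊛-identityˡ f (suc n) = ≡.trans (≡.cong (f (suc n) xor_) (⊛-zeroˡ f n)) (xor-identityʳ _)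

-- The mirror image of the defining recursion, from which commutativity follows by induction.
⊛-sucʳ : ∀ f g n → (f ⊛ g) (suc n) ≡ (f (suc n) ∧ g 0) xor (f ⊛ g ∘ suc) n
⊛-sucʳ f g zero = solve 2 (λ a b → a :+ b := b :+ a) ≡.refl (f 0 ∧ g 1) (f 1 ∧ g 0)
⊛-sucʳ f g (suc n) = ≡.trans (≡.cong ((f 0 ∧ g (suc (suc n))) xor_) (⊛-sucʳ (f ∘ suc) g n))
  (solve 3 (λ a b c → a :+ (b :+ c) := b :+ (a :+ c)) ≡.refl (f 0 ∧ g (suc (suc n))) (f (suc (suc n)) ∧ g 0) _)

⊛-comm : ∀ f g → f ⊛ g ≗ g ⊛ f
⊛-comm f g zero = ∧-comm (f 0) (g 0)
⊛-comm f g (suc n) = ≡.trans (≡.cong₂ _xor_ (∧-comm (f 0) (g (suc n))) (⊛-comm (f ∘ suc) g n)) (≡.sym (⊛-sucʳ g f n))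

⊛-assoc : ∀ f g h → (f ⊛ g) ⊛ h ≗ f ⊛ (g ⊛ h)
⊛-assoc f g h zero = solve 3 (λ a b c → a :* b :* c := a :* (b :* c)) ≡.refl (f 0) (g 0) (h 0)
⊛-assoc f g h (suc n) = begin
  ((f 0 ∧ g 0) ∧ h (suc n)) xor ((f 0 ∙ (g ∘ suc) ⊕ f ∘ suc ⊛ g) ⊛ h) n
    ≡⟨ ≡.cong (((f 0 ∧ g 0) ∧ h (suc n)) xor_) (⊛-distribʳ (f 0 ∙ (g ∘ suc)) (f ∘ suc ⊛ g) h n) ⟩
  ((f 0 ∧ g 0) ∧ h (suc n)) xor (((f 0 ∙ (g ∘ suc)) ⊛ h) n xor ((f ∘ suc ⊛ g) ⊛ h) n)
    ≡⟨ ≡.cong (((f 0 ∧ g 0) ∧ h (suc n)) xor_) (≡.cong₂ _xor_ (∙-⊛ (f 0) (g ∘ suc) h n) (⊛-assoc (f ∘ suc) g h n)) ⟩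
  ((f 0 ∧ g 0) ∧ h (suc n)) xor ((f 0 ∧ (g ∘ suc ⊛ h) n) xor (f ∘ suc ⊛ (g ⊛ h)) n)
    ≡⟨ solve 5 (λ a b c u v → a :* b :* c :+ (a :* u :+ v) := a :* (b :* c :+ u) :+ v) ≡.refl (f 0) (g 0) (h (suc n)) _ _ ⟩
  (f ⊛ (g ⊛ h)) (suc n) ∎
  where open ≡.≡-Reasoning

record _≈[_]_ (f : 𝔽₂⟦q⟧) (N : ℕ) (g : 𝔽₂⟦q⟧) : Set where
  constructor mod
  field coeff : ∀ n → n ≤ N → f n ≡ g n
open _≈[_]_ public

≗⇒≈ : ∀ {N f g} → f ≗ g → f ≈[ N ] g
≗⇒≈ e = mod (λ n _ → e n)

truncatedRing : ℕ → CommutativeRing 0ℓ 0ℓ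
truncatedRing N = record
  { Carrier = 𝔽₂⟦q⟧
  ; _≈_ = _≈[ N ]_
  ; _+_ = _⊕_
  ; _*_ = _⊛_
  ; -_ = λ f → f
  ; 0# = 𝟘
  ; 1# = 𝟙
  ; isCommutativeRing = record
    { isRing = record
      { +-isAbelianGroup = record
        { isGroup = record
          { isMonoid = record
            { isSemigroup = record
              { isMagma = record
                { isEquivalence = record
                  { refl = mod (λ _ _ → ≡.refl)
                  ; sym = λ (mod e) → mod (λ n n≤N → ≡.sym (e n n≤N))
                  ; trans = λ (mod e₁) (mod e₂) → mod (λ n n≤N → ≡.trans (e₁ n n≤N) (e₂ n n≤N))
                  }
                ; ∙-cong = λ (mod e₁) (mod e₂) → mod (λ n n≤N → ≡.cong₂ _xor_ (e₁ n n≤N) (e₂ n n≤N))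
                }
              ; assoc = λ f g h → ≗⇒≈ (λ n → B₂.+-assoc (f n) (g n) (h n))
              }
            ; identity = (λ f → ≗⇒≈ (λ _ → ≡.refl)) , (λ f → ≗⇒≈ (λ n → xor-identityʳ (f n)))
            }
          ; inverse = (λ f → ≗⇒≈ (λ n → xor-same (f n))) , (λ f → ≗⇒≈ (λ n → xor-same (f n)))
          ; ⁻¹-cong = λ e → e
          }
        ; comm = λ f g → ≗⇒≈ (λ n → B₂.+-comm (f n) (g n))
        }
      ; *-cong = λ (mod e₁) (mod e₂) → mod (λ n n≤N → ⊛-cong n (λ i i≤n → e₁ i (ℕ.≤-trans i≤n n≤N)) (λ i i≤n → e₂ i (ℕ.≤-trans i≤n n≤N)))
      ; *-assoc = λ f g h → ≗⇒≈ (⊛-assoc f g h)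
      ; *-identity = (λ f → ≗⇒≈ (⊛-identityˡ f)) , (λ f → ≗⇒≈ (λ n → ≡.trans (⊛-comm f 𝟙 n) (⊛-identityˡ f n)))
      ; distrib = (λ f g h → ≗⇒≈ (λ n → ≡.trans (⊛-comm f (g ⊕ h) n) (≡.trans (⊛-distribʳ g h f n) (≡.cong₂ _xor_ (⊛-comm g f n) (⊛-comm h f n)))))
                , (λ h f g → ≗⇒≈ (⊛-distribʳ f g h))
      }
    ; *-comm = λ f g → ≗⇒≈ (⊛-comm f g)
    }
  }

module Truncated (N : ℕ) where
  open Char2 (truncatedRing N) (≗⇒≈ (λ n → xor-same (𝟙 n))) public
  open Nilpotent (truncatedRing N) (≗⇒≈ (λ n → xor-same (𝟙 n))) N public

-- Residue classes of exponents, and cancellation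

section : ℕ → 𝔽₂⟦q⟧ → 𝔽₂⟦q⟧
section r f n = f (n ℕ.* 2 ℕ.+ r)

private
  square-1 : ∀ f → (f ⊛ f) 1 ≡ false
  square-1 f = ≡.trans (≡.cong ((f 0 ∧ f 1) xor_) (∧-comm (f 1) (f 0))) (xor-same (f 0 ∧ f 1))

  square-2+ : ∀ f n → (f ⊛ f) (suc (suc n)) ≡ (f ∘ suc ⊛ f ∘ suc) n
  square-2+ f n = ≡.trans (≡.cong ((f 0 ∧ f (suc (suc n))) xor_) (⊛-sucʳ (f ∘ suc) f n))
    (solve 3 (λ a b c → a :* b :+ (b :* a :+ c) := c) ≡.refl (f 0) (f (suc (suc n))) _)

  square-⊛-0 : ∀ f g → ((f ⊛ f) ⊛ g) 0 ≡ f 0 ∧ g 0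
  square-⊛-0 f g = ≡.cong (_∧ g 0) (∧-idem (f 0))

  square-⊛-1 : ∀ f g → ((f ⊛ f) ⊛ g) 1 ≡ f 0 ∧ g 1
  square-⊛-1 f g = ≡.trans (≡.cong₂ _xor_ (≡.cong (_∧ g 1) (∧-idem (f 0))) (≡.cong (_∧ g 0) (square-1 f))) (xor-identityʳ _)

  -- A square has no term of degree 1, and without its two lowest terms it is the square of
  -- `f ∘ suc`, shifted by two degrees.
  square-⊛-2+ : ∀ f g n → ((f ⊛ f) ⊛ g) (suc (suc n)) ≡ (f 0 ∧ g (suc (suc n))) xor ((f ∘ suc ⊛ f ∘ suc) ⊛ g) n
  square-⊛-2+ f g n = ≡.cong₂ _xor_ (≡.cong (_∧ g (suc (suc n))) (∧-idem (f 0)))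
    (≡.trans (≡.cong₂ _xor_ (≡.cong (_∧ g (suc n)) (square-1 f)) (⊛-congʳ g (square-2+ f) n)) ≡.refl)

-- f(q)² = f(q²) modulo 2
section-square : ∀ r → r < 2 → ∀ f g → section r ((f ⊛ f) ⊛ g) ≗ f ⊛ section r g
section-square 0 _ f g zero = square-⊛-0 f g
section-square 1 _ f g zero = square-⊛-1 f g
section-square (suc (suc r)) (s≤s (s≤s ())) f g zero
section-square r r<2 f g (suc n) = ≡.trans (square-⊛-2+ f g (n ℕ.* 2 ℕ.+ r))
  (≡.cong ((f 0 ∧ g (suc (suc (n ℕ.* 2 ℕ.+ r)))) xor_) (section-square r r<2 (f ∘ suc) g n))

-- The square rule is applied to f² and then to f. The residue modulo 4 is 2r′ + r: the inner
-- section carries the low bit.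
section-fourth : ∀ r r′ → r < 2 → r′ < 2 → ∀ f g → section r′ (section r ((f ⊛ f) ⊛ (f ⊛ f) ⊛ g)) ≗ f ⊛ section r′ (section r g)
section-fourth r r′ r<2 r′<2 f g n = ≡.trans (section-square r r<2 (f ⊛ f) g (n ℕ.* 2 ℕ.+ r′)) (section-square r′ r′<2 f (section r g) n)

-- The lowest nonzero coefficient of `g` would survive in the product. `go` has the factors swapped
-- since the recursion of `⊛` shifts its left factor.
⊛-cancelˡ-zero : ∀ f g n → f 0 ≡ true → (∀ i → i ≤ n → (f ⊛ g) i ≡ false) → g n ≡ false
⊛-cancelˡ-zero f g n f₀ = go n g ∘ (λ e i i≤n → ≡.trans (⊛-comm g f i) (e i i≤n))
  where
  head : ∀ g → (g ⊛ f) 0 ≡ false → g 0 ≡ false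
  head g e with g 0 | f 0
  head g e | false | _ = ≡.refl
  head g e | true | true = e
  head g e | true | false = contradiction f₀ (λ ())
  go : ∀ n g → (∀ i → i ≤ n → (g ⊛ f) i ≡ false) → g n ≡ false
  go zero g e = head g (e 0 z≤n)
  go (suc n) g e = go n (g ∘ suc) λ i i≤n →
    ≡.trans (≡.cong (λ b → (b ∧ f (suc i)) xor (g ∘ suc ⊛ f) i) (≡.sym (head g (e 0 z≤n)))) (e (suc i) (s≤s i≤n))

xor≡false⇒≡ : ∀ {a b} → a xor b ≡ false → a ≡ b
xor≡false⇒≡ {false} {false} _ = ≡.refl
xor≡false⇒≡ {true} {true} _ = ≡.refl

⊛-cancelˡ : ∀ f g h n → f 0 ≡ true → (∀ i → i ≤ n → (f ⊛ g) i ≡ (f ⊛ h) i) → g n ≡ h n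
⊛-cancelˡ f g h n f₀ e = xor≡false⇒≡ (⊛-cancelˡ-zero f (g ⊕ h) n f₀ λ i i≤n → begin
  (f ⊛ (g ⊕ h)) i            ≡⟨ ⊛-comm f (g ⊕ h) i ⟩
  ((g ⊕ h) ⊛ f) i            ≡⟨ ⊛-distribʳ g h f i ⟩
  (g ⊛ f) i xor (h ⊛ f) i    ≡⟨ ≡.cong₂ _xor_ (⊛-comm g f i) (⊛-comm h f i) ⟩
  (f ⊛ g) i xor (f ⊛ h) i    ≡⟨ ≡.cong (_xor (f ⊛ h) i) (e i i≤n) ⟩
  (f ⊛ h) i xor (f ⊛ h) i    ≡⟨ xor-same ((f ⊛ h) i) ⟩
  false ∎)
  where open ≡.≡-Reasoning

shift : ℕ → 𝔽₂⟦q⟧ → 𝔽₂⟦q⟧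
shift zero f n = f n
shift (suc k) f zero = false
shift (suc k) f (suc n) = shift k f n

q-⊛ : ∀ f → q ⊛ f ≗ shift 1 f
q-⊛ f zero = ≡.refl
q-⊛ f (suc n) = ⊛-identityˡ f n

module _ (N : ℕ) where
  open Truncated N

  q^-⊛ : ∀ k f → q ^ k ⊛ f ≗ shift k f
  q^-⊛ zero f n = ⊛-identityˡ f n
  q^-⊛ (suc k) f n = ≡.trans (⊛-assoc q (q ^ k) f n) (≡.trans (q-⊛ (q ^ k ⊛ f) n) (lemma n))
    where
    lemma : shift 1 (q ^ k ⊛ f) ≗ shift (suc k) f
    lemma zero = ≡.refl
    lemma (suc n) = q^-⊛ k f n

  q^-coeff : ∀ k n → (q ^ k) n ≡ (k ≡ᵇ n)
  q^-coeff zero zero = ≡.refl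
  q^-coeff zero (suc n) = ≡.refl
  q^-coeff (suc k) zero = ≡.refl
  q^-coeff (suc k) (suc n) = ≡.trans (q-⊛ (q ^ k) (suc n)) (q^-coeff k n)

  q-vanishing : Vanishing q
  q-vanishing m N<m = mod λ n n≤N → ≡.trans (q^-coeff m n) (large (ℕ.<-≤-trans (s≤s n≤N) N<m))
    where
    large : ∀ {m n} → n < m → (m ≡ᵇ n) ≡ false
    large {suc m} {zero} _ = ≡.refl
    large {suc m} {suc n} (s≤s n<m) = large n<m

  Σ-coeff : ∀ k (F : ℕ → 𝔽₂⟦q⟧) n → Σ< k F n ≡ 𝔽₂.Σ< k (λ i → F i n)
  Σ-coeff zero F n = ≡.refl
  Σ-coeff (suc k) F n = ≡.cong (_xor F k n) (Σ-coeff k F n)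

  eulerProd-constant : ∀ f n → f 0 ≡ false → eulerProd f n 0 ≡ true
  eulerProd-constant f zero _ = ≡.refl
  eulerProd-constant f (suc n) f₀ = ≡.cong₂ _∧_ (eulerProd-constant f n f₀) (≡.cong (λ b → true xor (b ∧ (f ^ n) 0)) f₀)

open import Data.Nat using (_+_; _*_)
open import Relation.Binary.PropositionalEquality using (refl; sym; trans; cong; cong₂; subst)

-- Counting lattice points modulo 2

-- Off the diagonal, `M i j` and `M j i` cancel.
Σ-symmetric : ∀ n (M : ℕ → ℕ → Bool) → (∀ i j → M i j ≡ M j i) →
  𝔽₂.Σ< n (λ i → 𝔽₂.Σ< n (M i)) ≡ 𝔽₂.Σ< n (λ i → M i i)
Σ-symmetric zero M M-sym = refl
Σ-symmetric (suc n) M M-sym = begin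
  𝔽₂.Σ< n (λ i → 𝔽₂.Σ< n (M i) xor M i n) xor (𝔽₂.Σ< n (M n) xor M n n)
    ≡⟨ cong (_xor (𝔽₂.Σ< n (M n) xor M n n)) (𝔽₂.Σ-+ n _ _) ⟩
  (𝔽₂.Σ< n (λ i → 𝔽₂.Σ< n (M i)) xor 𝔽₂.Σ< n (λ i → M i n)) xor (𝔽₂.Σ< n (M n) xor M n n)
    ≡⟨ cong (λ u → (𝔽₂.Σ< n (λ i → 𝔽₂.Σ< n (M i)) xor u) xor (𝔽₂.Σ< n (M n) xor M n n)) (𝔽₂.Σ-cong n (λ i _ → M-sym i n)) ⟩
  (𝔽₂.Σ< n (λ i → 𝔽₂.Σ< n (M i)) xor 𝔽₂.Σ< n (M n)) xor (𝔽₂.Σ< n (M n) xor M n n)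
    ≡⟨ solve 3 (λ a b c → (a :+ b) :+ (b :+ c) := a :+ c) refl (𝔽₂.Σ< n (λ i → 𝔽₂.Σ< n (M i))) (𝔽₂.Σ< n (M n)) (M n n) ⟩
  𝔽₂.Σ< n (λ i → 𝔽₂.Σ< n (M i)) xor M n n
    ≡⟨ cong (_xor M n n) (Σ-symmetric n M M-sym) ⟩
  𝔽₂.Σ< n (λ i → M i i) xor M n n ∎
  where open ≡.≡-Reasoning

Unique< : ℕ → (ℕ → Bool) → Set
Unique< n p = ∀ i j → i < n → j < n → p i ≡ true → p j ≡ true → i ≡ j

Exists< : ℕ → (ℕ → Bool) → Set
Exists< n p = ∃[ i ] i < n × p i ≡ true

exists? : ∀ n p → Exists< n p ⊎ (∀ i → i < n → p i ≡ false)
exists? zero p = inj₂ λ _ ()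
exists? (suc n) p with exists? n p | p n in eq
... | inj₁ (i , i<n , pᵢ) | _ = inj₁ (i , ℕ.m<n⇒m<1+n i<n , pᵢ)
... | inj₂ none | true = inj₁ (n , ℕ.≤-refl , eq)
... | inj₂ none | false = inj₂ λ i i≤n → Sum.[ none i , (λ { refl → eq }) ] (ℕ.m≤n⇒m<n∨m≡n (ℕ.≤-pred i≤n))

Σ-unique : ∀ n p → Unique< n p → Exists< n p → 𝔽₂.Σ< n p ≡ true
Σ-unique (suc n) p unique (i , i≤n , pᵢ) with ℕ.m≤n⇒m<n∨m≡n (ℕ.≤-pred i≤n)
... | inj₂ refl = trans (cong (_xor p n) (𝔽₂.Σ-zero n (λ j j<n → ¬-not λ pⱼ → ℕ.<⇒≢ j<n (unique j n (ℕ.m<n⇒m<1+n j<n) ℕ.≤-refl pⱼ pᵢ)))) pᵢ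
... | inj₁ i<n = trans (cong₂ _xor_ (Σ-unique n p (λ j k j<n k<n → unique j k (ℕ.m<n⇒m<1+n j<n) (ℕ.m<n⇒m<1+n k<n)) (i , i<n , pᵢ))
    (¬-not λ pₙ → ℕ.<⇒≢ i<n (unique i n (ℕ.m<n⇒m<1+n i<n) ℕ.≤-refl pᵢ pₙ))) refl

-- With at most one witness, each sum only records existence, so existence is all that has to be
-- carried across; no bijection of the ranges is built.
Σ-unique-match : ∀ m n {p r} → Unique< m p → Unique< n r →
  (Exists< m p → Exists< n r) → (Exists< n r → Exists< m p) → 𝔽₂.Σ< m p ≡ 𝔽₂.Σ< n r
Σ-unique-match m n {p} {r} unique-p unique-r to from with exists? m p
... | inj₁ ∃p = trans (Σ-unique m p unique-p ∃p) (sym (Σ-unique n r unique-r (to ∃p)))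
... | inj₂ none with exists? n r
...   | inj₁ ∃r with (i , i<m , pᵢ) ← from ∃r = contradiction (trans (sym pᵢ) (none i i<m)) λ ()
...   | inj₂ none′ = trans (𝔽₂.Σ-zero m none) (sym (𝔽₂.Σ-zero n none′))

does-true⁻ : ∀ {a} {A : Set a} (a? : Dec A) → does a? ≡ true → A
does-true⁻ (yes a) _ = a

≡ᵇ-true : ∀ {m n} → m ≡ n → (m ≡ᵇ n) ≡ true
≡ᵇ-true {m} {n} e = Equivalence.to T-≡ (ℕ.≡⇒≡ᵇ m n e)

≡ᵇ-true⁻ : ∀ {m n} → (m ≡ᵇ n) ≡ true → m ≡ n
≡ᵇ-true⁻ {m} {n} e = ℕ.≡ᵇ⇒≡ m n (Equivalence.from T-≡ e)

≡ᵇ-false : ∀ {m n} → m ≢ n → (m ≡ᵇ n) ≡ false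
≡ᵇ-false m≢n = ¬-not (m≢n ∘ ≡ᵇ-true⁻)

≡ᵇ-cong : ∀ {m n k l} → (m ≡ n → k ≡ l) → (k ≡ l → m ≡ n) → (m ≡ᵇ n) ≡ (k ≡ᵇ l)
≡ᵇ-cong {m} {n} {k} {l} to from with m ℕ.≟ n
... | yes e = trans (≡ᵇ-true e) (sym (≡ᵇ-true (to e)))
... | no ne = trans (≡ᵇ-false ne) (sym (≡ᵇ-false (ne ∘ from)))

even≢odd : ∀ a b → 2 * a ≢ suc (2 * b)
even≢odd zero b ()
even≢odd (suc a) zero e = contradiction (trans (sym (ℕ.*-suc 2 a)) e) λ ()
even≢odd (suc a) (suc b) e = even≢odd a b (ℕ.suc-injective (ℕ.suc-injective (trans (sym (ℕ.*-suc 2 a)) (trans e (cong suc (ℕ.*-suc 2 b))))))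

parity : ∀ n → ∃[ k ] (n ≡ 2 * k ⊎ n ≡ suc (2 * k))
parity zero = 0 , inj₁ refl
parity (suc n) with parity n
... | k , inj₁ e = k , inj₂ (cong suc e)
... | k , inj₂ e = suc k , inj₁ (trans (cong suc e) (sym (ℕ.*-suc 2 k)))

odd : ℕ → ℕ
odd n = suc (2 * n)

odd-square : ∀ n → odd n * odd n ≡ suc (8 * triangle n)
odd-square n = trans (eq₁ n) (trans (cong (λ u → suc (4 * u)) (sym (2*triangle n))) (eq₂ (triangle n)))
  where
  eq₁ : ∀ n → suc (2 * n) * suc (2 * n) ≡ suc (4 * (n * suc n))
  eq₁ = solve-∀
  eq₂ : ∀ t → suc (4 * (2 * t)) ≡ suc (8 * t)
  eq₂ = solve-∀

triangle-mono-< : ∀ {m n} → m < n → triangle m < triangle n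
triangle-mono-< {m} {suc n} (s≤s m≤n) with ℕ.m≤n⇒m<n∨m≡n m≤n
... | inj₂ refl = s≤s (ℕ.m≤n+m (triangle m) m)
... | inj₁ m<n = ℕ.<-≤-trans (triangle-mono-< m<n) (ℕ.m≤n+m (triangle n) (suc n))

triangle-injective : ∀ {m n} → triangle m ≡ triangle n → m ≡ n
triangle-injective {m} {n} e with ℕ.<-cmp m n
... | tri< m<n _ _ = contradiction e (ℕ.<⇒≢ (triangle-mono-< m<n))
... | tri≈ _ m≡n _ = m≡n
... | tri> _ _ n<m = contradiction (sym e) (ℕ.<⇒≢ (triangle-mono-< n<m))

-- With x = 2i + 1, y = 2t + 1 and c = 4d² − 1, a link between x, y and w says x = ±y ± 2dw; then
-- x² + cy² = 4d(d(y² + w²) ± yw), and the right hand side is symmetric in y and w.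
data Link (d i t w : ℕ) : Set where
  plus : i ≡ t + d * w → Link d i t w
  minus : t ≡ i + d * w → Link d i t w
  cross : suc (i + t) ≡ d * w → Link d i t w

-- As 8T + 1 is an odd square, eight times e(T_i + c T_t) = m reads e(x² + cy²) = 8m + e(c + 1) with
-- x = 2i + 1, y = 2t + 1. The two hypotheses turn the right hand side into 4dK.
module Lattice (d e c K m : ℕ) .{{_ : NonZero d}} .{{_ : NonZero e}}
  (c+1≡4d² : suc c ≡ 4 * (d * d)) (2m+d²e≡dK : 2 * m + d * d * e ≡ d * K) where

  -- The two signs in e(d(y² + w²) ± yw) = K, with the negative term moved to the other side.
  Related : ℕ → ℕ → Set
  Related y w = (e * (d * (y * y + w * w) + y * w) ≡ K) ⊎ (e * (d * (y * y + w * w)) ≡ K + e * (y * w))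

  related? : ∀ y w → Dec (Related y w)
  related? y w = (_ ℕ.≟ _) ⊎-dec (_ ℕ.≟ _)

  related-sym : ∀ {y w} → Related y w → Related w y
  related-sym {y} {w} = Sum.map (trans (eq₁ e d w y)) (λ h → trans (eq₂ e d w y) (trans h (cong (λ u → K + e * u) (ℕ.*-comm y w))))
    where
    eq₁ : ∀ e d y w → e * (d * (y * y + w * w) + y * w) ≡ e * (d * (w * w + y * y) + w * y)
    eq₁ = solve-∀
    eq₂ : ∀ e d y w → e * (d * (y * y + w * w)) ≡ e * (d * (w * w + y * y))
    eq₂ = solve-∀

  Solution : ℕ → ℕ → Set
  Solution i t = e * (triangle i + c * triangle t) ≡ m

  private
    Norm : ℕ → ℕ → ℕ
    Norm i t = e * (odd i * odd i + c * (odd t * odd t))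

    norm-triangle : ∀ i t → Norm i t ≡ 8 * (e * (triangle i + c * triangle t)) + e * (4 * (d * d))
    norm-triangle i t = trans (cong₂ (λ u v → e * (u + c * v)) (odd-square i) (odd-square t))
      (trans (eq e c (triangle i) (triangle t)) (cong (λ u → 8 * (e * (triangle i + c * triangle t)) + e * u) c+1≡4d²))
      where
      eq : ∀ e c u v → e * (suc (8 * u) + c * suc (8 * v)) ≡ 8 * (e * (u + c * v)) + e * suc c
      eq = solve-∀

    4dK : 8 * m + e * (4 * (d * d)) ≡ 4 * d * K
    4dK = trans (eq m e d) (trans (cong (4 *_) 2m+d²e≡dK) (sym (ℕ.*-assoc 4 d K)))
      where
      eq : ∀ m e d → 8 * m + e * (4 * (d * d)) ≡ 4 * (2 * m + d * d * e)
      eq = solve-∀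

    norm⇒solution : ∀ i t → Norm i t ≡ 4 * d * K → Solution i t
    norm⇒solution i t h = ℕ.*-cancelˡ-≡ _ _ 8 (ℕ.+-cancelʳ-≡ _ _ _ (trans (sym (norm-triangle i t)) (trans h (sym 4dK))))

    solution⇒norm : ∀ i t → Solution i t → Norm i t ≡ 4 * d * K
    solution⇒norm i t h = trans (norm-triangle i t) (trans (cong (λ u → 8 * u + e * (4 * (d * d))) h) 4dK)

    -- The added ey² completes c to 4d² and so avoids the subtraction in c = 4d² - 1.
    norm+y² : ∀ i t → Norm i t + e * (odd t * odd t) ≡ e * (odd i * odd i) + e * (4 * (d * d) * (odd t * odd t))
    norm+y² i t = trans (eq e c (odd i) (odd t)) (cong (λ u → e * (odd i * odd i) + e * (u * (odd t * odd t))) c+1≡4d²)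
      where
      eq : ∀ e c x y → e * (x * x + c * (y * y)) + e * (y * y) ≡ e * (x * x) + e * (suc c * (y * y))
      eq = solve-∀

    odd-plus : ∀ i t w → i ≡ t + d * w → odd i ≡ odd t + 2 * (d * w)
    odd-plus i t w refl = cong suc (ℕ.*-distribˡ-+ 2 t (d * w))

    odd-cross : ∀ i t w → suc (i + t) ≡ d * w → odd i + odd t ≡ 2 * (d * w)
    odd-cross i t w h = trans (eq i t) (cong (2 *_) h)
      where
      eq : ∀ i t → suc (2 * i) + suc (2 * t) ≡ 2 * suc (i + t)
      eq = solve-∀

    norm-plus : ∀ i t w → i ≡ t + d * w → Norm i t ≡ 4 * d * (e * (d * (odd t * odd t + w * w) + odd t * w))
    norm-plus i t w h = ℕ.+-cancelʳ-≡ (e * (odd t * odd t)) _ _ (trans (norm+y² i t)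
      (trans (cong (λ x → e * (x * x) + e * (4 * (d * d) * (odd t * odd t))) (odd-plus i t w h)) (eq e d (odd t) w)))
      where
      eq : ∀ e d y w → e * ((y + 2 * (d * w)) * (y + 2 * (d * w))) + e * (4 * (d * d) * (y * y))
        ≡ 4 * d * (e * (d * (y * y + w * w) + y * w)) + e * (y * y)
      eq = solve-∀

    -- The hypothesis is x² = (y - 2dw)² without subtraction; it covers both x = y - 2dw and x = 2dw
    -- - y.
    norm-minus : ∀ i t w → odd i * odd i + 2 * (odd t * (2 * (d * w))) ≡ 2 * (d * w) * (2 * (d * w)) + odd t * odd t →
      Norm i t + 4 * d * (e * (odd t * w)) ≡ 4 * d * (e * (d * (odd t * odd t + w * w)))
    norm-minus i t w h = ℕ.+-cancelʳ-≡ (e * (odd t * odd t)) _ _ (trans (swap (Norm i t) _ _)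
      (trans (cong (_+ 4 * d * (e * (odd t * w))) (norm+y² i t)) (trans (eq₁ e d (odd i) (odd t) w)
      (trans (cong (λ u → e * u + e * (4 * (d * d) * (odd t * odd t))) h) (eq₂ e d (odd t) w)))))
      where
      swap : ∀ a b c → a + b + c ≡ a + c + b
      swap = solve-∀
      eq₁ : ∀ e d x y w → e * (x * x) + e * (4 * (d * d) * (y * y)) + 4 * d * (e * (y * w))
        ≡ e * (x * x + 2 * (y * (2 * (d * w)))) + e * (4 * (d * d) * (y * y))
      eq₁ = solve-∀
      eq₂ : ∀ e d y w → e * (2 * (d * w) * (2 * (d * w)) + y * y) + e * (4 * (d * d) * (y * y))
        ≡ 4 * d * (e * (d * (y * y + w * w))) + e * (y * y)
      eq₂ = solve-∀

    norm-other : ∀ i t w → t ≡ i + d * w ⊎ suc (i + t) ≡ d * w →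
      Norm i t + 4 * d * (e * (odd t * w)) ≡ 4 * d * (e * (d * (odd t * odd t + w * w)))
    norm-other i t w (inj₁ h) = norm-minus i t w
      (trans (cong (λ y → odd i * odd i + 2 * (y * (2 * (d * w)))) (odd-plus t i w h))
      (trans (eq (odd i) (2 * (d * w))) (cong (λ y → 2 * (d * w) * (2 * (d * w)) + y * y) (sym (odd-plus t i w h)))))
      where
      eq : ∀ x z → x * x + 2 * ((x + z) * z) ≡ z * z + (x + z) * (x + z)
      eq = solve-∀
    norm-other i t w (inj₂ h) = norm-minus i t w
      (trans (cong (λ z → odd i * odd i + 2 * (odd t * z)) (sym (odd-cross i t w h)))
      (trans (eq (odd i) (odd t)) (cong (λ z → z * z + odd t * odd t) (odd-cross i t w h))))
      where
      eq : ∀ x y → x * x + 2 * (y * (x + y)) ≡ (x + y) * (x + y) + y * y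
      eq = solve-∀

    instance
      4d≢0 : NonZero (4 * d)
      4d≢0 = ℕ.m*n≢0 4 d

    other⇒related : ∀ i t w → t ≡ i + d * w ⊎ suc (i + t) ≡ d * w → Solution i t → Related (odd t) w
    other⇒related i t w h sol = inj₂ (ℕ.*-cancelˡ-≡ _ _ (4 * d) (trans (sym (norm-other i t w h))
      (trans (cong (_+ 4 * d * (e * (odd t * w))) (solution⇒norm i t sol)) (sym (ℕ.*-distribˡ-+ (4 * d) K (e * (odd t * w)))))))

    other⇒solution : ∀ i t w → t ≡ i + d * w ⊎ suc (i + t) ≡ d * w →
      e * (d * (odd t * odd t + w * w)) ≡ K + e * (odd t * w) → Solution i t
    other⇒solution i t w h rel = norm⇒solution i t (ℕ.+-cancelʳ-≡ (4 * d * (e * (odd t * w))) _ _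
      (trans (norm-other i t w h) (trans (cong (4 * d *_) rel) (ℕ.*-distribˡ-+ (4 * d) K (e * (odd t * w))))))

  link⇒related : ∀ i t w → Link d i t w → Solution i t → Related (odd t) w
  link⇒related i t w (plus h) sol = inj₁ (ℕ.*-cancelˡ-≡ _ _ (4 * d) (trans (sym (norm-plus i t w h)) (solution⇒norm i t sol)))
  link⇒related i t w (minus h) sol = other⇒related i t w (inj₁ h) sol
  link⇒related i t w (cross h) sol = other⇒related i t w (inj₂ h) sol

  -- x is y + 2dw or |y - 2dw|. In the second case y - 2dw is positive exactly when dw ≤ t.
  related⇒link : ∀ t w → Related (odd t) w → ∃[ i ] Link d i t w × Solution i t
  related⇒link t w (inj₁ rel) = t + d * w , plus refl ,
    norm⇒solution (t + d * w) t (trans (norm-plus (t + d * w) t w refl) (cong (4 * d *_) rel))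
  related⇒link t w (inj₂ rel) with d * w ℕ.≤? t
  ... | yes dw≤t = t ℕ.∸ d * w , minus h , other⇒solution _ t w (inj₁ h) rel
    where h = sym (ℕ.m∸n+n≡m dw≤t)
  ... | no dw≰t = d * w ℕ.∸ suc t , cross h , other⇒solution _ t w (inj₂ h) rel
    where h = trans (sym (ℕ.+-suc (d * w ℕ.∸ suc t) t)) (ℕ.m∸n+n≡m (ℕ.≰⇒> dw≰t))

  private
    odd-multiple : ∀ a j k → suc (2 * a) + d * odd j ≢ d * odd k
    odd-multiple a j k h = even≢odd (d * k) (a + d * j) (ℕ.+-cancelʳ-≡ d _ _ (trans (eq₁ d k) (trans (sym h) (eq₂ d a j))))
      where
      eq₁ : ∀ d k → 2 * (d * k) + d ≡ d * suc (2 * k)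
      eq₁ = solve-∀
      eq₂ : ∀ d a j → suc (2 * a) + d * suc (2 * j) ≡ suc (2 * (a + d * j)) + d
      eq₂ = solve-∀

    odd-cancel : ∀ j k → d * odd j ≡ d * odd k → j ≡ k
    odd-cancel j k h = ℕ.*-cancelˡ-≡ j k 2 (ℕ.suc-injective (ℕ.*-cancelˡ-≡ (odd j) (odd k) d h))

    n≢n+m+dj : ∀ n m j → n ≢ n + m + d * odd j
    n≢n+m+dj n m j h = ℕ.<⇒≢ (ℕ.≤-<-trans (ℕ.m≤m+n n m) (ℕ.m<m+n (n + m) (ℕ.n≢0⇒n>0 (ℕ.≢-nonZero⁻¹ _ {{ℕ.m*n≢0 d (odd j)}})))) h

    plus-minus : ∀ {i t j k} → i ≡ t + d * odd j → t ≢ i + d * odd k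
    plus-minus {i} {t} {j} {k} refl h = n≢n+m+dj t (d * odd j) k h

    plus-cross : ∀ {i t j k} → i ≡ t + d * odd j → suc (i + t) ≢ d * odd k
    plus-cross {i} {t} {j} {k} refl h = odd-multiple t j k (trans (eq t (d * odd j)) h)
      where
      eq : ∀ t u → suc (2 * t) + u ≡ suc (t + u + t)
      eq = solve-∀

    minus-cross : ∀ {i t j k} → t ≡ i + d * odd j → suc (i + t) ≢ d * odd k
    minus-cross {i} {t} {j} {k} h h′ = plus-cross {t} {i} {j} {k} h (trans (cong suc (ℕ.+-comm t i)) h′)

  -- `plus` and `minus` exclude each other because `d * odd j` is positive. Both exclude `cross`: |i
  -- - t| and i + t + 1 differ by an odd number, two odd multiples of `d` by an even one. With
  -- arbitrary w both would qualify for d = 1.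
  link-unique : ∀ i t j k → Link d i t (odd j) → Link d i t (odd k) → j ≡ k
  link-unique i t j k (plus h) (plus h′) = odd-cancel j k (ℕ.+-cancelˡ-≡ t _ _ (trans (sym h) h′))
  link-unique i t j k (plus h) (minus h′) = contradiction h′ (plus-minus {j = j} {k} h)
  link-unique i t j k (plus h) (cross h′) = contradiction h′ (plus-cross {j = j} {k} h)
  link-unique i t j k (minus h) (plus h′) = contradiction h (plus-minus {j = k} {j} h′)
  link-unique i t j k (minus h) (minus h′) = odd-cancel j k (ℕ.+-cancelˡ-≡ i _ _ (trans (sym h) h′))
  link-unique i t j k (minus h) (cross h′) = contradiction h′ (minus-cross {j = j} {k} h)
  link-unique i t j k (cross h) (plus h′) = contradiction h (plus-cross {j = k} {j} h′)
  link-unique i t j k (cross h) (minus h′) = contradiction h (minus-cross {j = k} {j} h′)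
  link-unique i t j k (cross h) (cross h′) = odd-cancel j k (trans (sym h) h′)

  solution-unique : ∀ i i′ t → Solution i t → Solution i′ t → i ≡ i′
  solution-unique i i′ t s s′ = triangle-injective (ℕ.+-cancelʳ-≡ (c * triangle t) _ _ (ℕ.*-cancelˡ-≡ _ _ e (trans s (sym s′))))

  solution-i≤m : ∀ i t → Solution i t → i ≤ m
  solution-i≤m i t sol = ℕ.≤-trans (n≤triangle i) (ℕ.≤-trans (ℕ.m≤m+n (triangle i) (c * triangle t)) (ℕ.≤-trans (ℕ.m≤n*m _ e) (ℕ.≤-reflexive sol)))

  solution-t≤m : .{{NonZero c}} → ∀ i t → Solution i t → t ≤ m
  solution-t≤m i t sol = ℕ.≤-trans (n≤triangle t) (ℕ.≤-trans (ℕ.m≤n*m (triangle t) c)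
    (ℕ.≤-trans (ℕ.m≤n+m (c * triangle t) (triangle i)) (ℕ.≤-trans (ℕ.m≤n*m _ e) (ℕ.≤-reflexive sol))))

  link-bound : ∀ i t j → i ≤ m → t ≤ m → Link d i t (odd j) → j < suc (2 * m)
  link-bound i t j i≤m t≤m link = ℕ.≤-trans (s≤s (ℕ.m≤m+n j _)) (ℕ.≤-trans (ℕ.m≤n*m (odd j) d) (bound link))
    where
    m≤ : m ≤ suc (2 * m)
    m≤ = ℕ.m≤n⇒m≤1+n (ℕ.m≤m+n m _)
    bound : Link d i t (odd j) → d * odd j ≤ suc (2 * m)
    bound (plus h) = ℕ.≤-trans (ℕ.m≤n+m _ t) (ℕ.≤-trans (ℕ.≤-reflexive (sym h)) (ℕ.≤-trans i≤m m≤))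
    bound (minus h) = ℕ.≤-trans (ℕ.m≤n+m _ i) (ℕ.≤-trans (ℕ.≤-reflexive (sym h)) (ℕ.≤-trans t≤m m≤))
    bound (cross h) = ℕ.≤-trans (ℕ.≤-reflexive (sym h)) (s≤s (ℕ.+-mono-≤ i≤m (ℕ.≤-trans t≤m (ℕ.m≤m+n m 0))))

  -- Summing a symmetric relation over 𝔽₂ leaves its diagonal.
  Σ-solutions : .{{NonZero c}} → (∀ i t → Solution i t → ∃[ j ] Link d i t (odd j)) →
    ∀ {a b} → m < a → 2 * m < b →
    𝔽₂.Σ< b (λ t → 𝔽₂.Σ< a (λ i → e * (triangle i + c * triangle t) ≡ᵇ m))
      ≡ 𝔽₂.Σ< b (λ t → does (related? (odd t) (odd t)))
  Σ-solutions linked {a} {b} m<a 2m<b = trans (𝔽₂.Σ-cong b (λ t _ → row t))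
    (Σ-symmetric b (λ t j → does (related? (odd t) (odd j))) symmetric)
    where
    symmetric : ∀ t j → does (related? (odd t) (odd j)) ≡ does (related? (odd j) (odd t))
    symmetric t j = does-⇔ (mk⇔ (related-sym {odd t} {odd j}) (related-sym {odd j} {odd t})) (related? (odd t) (odd j)) (related? (odd j) (odd t))

    -- For fixed y there is at most one x and at most one odd w, and each yields the other.
    row : ∀ t → 𝔽₂.Σ< a (λ i → e * (triangle i + c * triangle t) ≡ᵇ m) ≡ 𝔽₂.Σ< b (λ j → does (related? (odd t) (odd j)))
    row t = Σ-unique-match a b
      (λ i i′ _ _ h h′ → solution-unique i i′ t (≡ᵇ-true⁻ h) (≡ᵇ-true⁻ h′))
      (λ j k _ _ h h′ → unique j k (related⇒link t (odd j) (does-true⁻ (related? (odd t) (odd j)) h)) (related⇒link t (odd k) (does-true⁻ (related? (odd t) (odd k)) h′)))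
      (λ (i , _ , h) → to i (≡ᵇ-true⁻ h) (linked i t (≡ᵇ-true⁻ h)))
      (λ (j , _ , h) → from j (related⇒link t (odd j) (does-true⁻ (related? (odd t) (odd j)) h)))
      where
      unique : ∀ j k → ∃[ i ] Link d i t (odd j) × Solution i t → ∃[ i ] Link d i t (odd k) × Solution i t → j ≡ k
      unique j k (i , link , sol) (i′ , link′ , sol′) with refl ← solution-unique i i′ t sol sol′ = link-unique i t j k link link′

      to : ∀ i → Solution i t → ∃[ j ] Link d i t (odd j) → Exists< b (λ j → does (related? (odd t) (odd j)))
      to i sol (j , link) = j
        , ℕ.<-≤-trans (link-bound i t j (solution-i≤m i t sol) (solution-t≤m i t sol) link) 2m<b
        , dec-true (related? (odd t) (odd j)) (link⇒related i t (odd j) link sol)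

      from : ∀ j → ∃[ i ] Link d i t (odd j) × Solution i t → Exists< a (λ i → e * (triangle i + c * triangle t) ≡ᵇ m)
      from _ (i , _ , sol) = i , ℕ.≤-<-trans (solution-i≤m i t sol) m<a , ≡ᵇ-true sol

-- The two quadratic forms and their diagonals

difference-odd : ∀ i t k → i + t ≡ suc (2 * k) → ∃[ j ] (i ≡ t + odd j ⊎ t ≡ i + odd j)
difference-odd zero t k h = k , inj₂ h
difference-odd (suc i) zero k h = k , inj₁ (trans (sym (ℕ.+-identityʳ (suc i))) h)
difference-odd (suc i) (suc t) zero h = contradiction (trans (sym (ℕ.+-suc i t)) (ℕ.suc-injective h)) λ ()
difference-odd (suc i) (suc t) (suc k) h with difference-odd i t k (ℕ.suc-injective (ℕ.suc-injective (trans (cong suc (sym (ℕ.+-suc i t))) (trans h (cong suc (ℕ.*-suc 2 k))))))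
... | j , s = j , Sum.map (cong suc) (cong suc) s

difference-even : ∀ i t k → i + t ≡ 2 * k → ∃[ j ] (i ≡ t + 2 * j ⊎ t ≡ i + 2 * j)
difference-even zero t k h = k , inj₂ h
difference-even (suc i) zero k h = k , inj₁ (trans (sym (ℕ.+-identityʳ (suc i))) h)
difference-even (suc i) (suc t) zero ()
difference-even (suc i) (suc t) (suc k) h with difference-even i t k (ℕ.suc-injective (ℕ.suc-injective (trans (cong suc (sym (ℕ.+-suc i t))) (trans h (ℕ.*-suc 2 k)))))
... | j , s = j , Sum.map (cong suc) (cong suc) s

-- At w = y the two signs would give 9y² = 8n + 7 and 3y² = 8n + 7, but y² is 1 modulo 8.
Ψ₃Ψ₉-parity : ∀ n {b} → 2 * (4 * n + 2) < b →
  𝔽₂.Σ< b (λ t → 𝔽₂.Σ< b (λ i → 3 * (triangle i + 3 * triangle t) ≡ᵇ 4 * n + 2)) ≡ false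
Ψ₃Ψ₉-parity n {b} 2m<b = trans (Σ-solutions linked (ℕ.≤-<-trans (ℕ.m≤n*m (4 * n + 2) 2) 2m<b) 2m<b)
  (𝔽₂.Σ-zero b (λ t _ → dec-false (related? (odd t) (odd t)) (diagonal t)))
  where
  eq : ∀ n → 2 * (4 * n + 2) + 1 * 1 * 3 ≡ 1 * (8 * n + 7)
  eq = solve-∀
  -- The factor e = 3 comes from the exponents 3T_i + 9T_t = 3(T_i + 3T_t), and K = 2m + 3.
  open Lattice 1 3 3 (8 * n + 7) (4 * n + 2) refl (eq n)

  linked : ∀ i t → Solution i t → ∃[ j ] Link 1 i t (odd j)
  linked i t _ with parity (i + t)
  ... | k , inj₁ h = k , cross (trans (cong suc h) (sym (ℕ.*-identityˡ (odd k))))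
  ... | k , inj₂ h with difference-odd i t k h
  ...   | j , inj₁ h′ = j , plus (trans h′ (cong (t +_) (sym (ℕ.*-identityˡ (odd j)))))
  ...   | j , inj₂ h′ = j , minus (trans h′ (cong (i +_) (sym (ℕ.*-identityˡ (odd j)))))

  diagonal : ∀ t → ¬ Related (odd t) (odd t)
  diagonal t (inj₁ h) = even≢odd (2 * n) (18 * T) (ℕ.*-cancelˡ-≡ _ _ 2 (ℕ.+-cancelʳ-≡ 7 _ _
    (trans (eq₁ n) (trans (sym h) (trans (eq₂ (odd t)) (trans (cong (9 *_) (odd-square t)) (eq₃ T)))))))
    where
    T = triangle t
    eq₁ : ∀ n → 2 * (2 * (2 * n)) + 7 ≡ 8 * n + 7
    eq₁ = solve-∀
    eq₂ : ∀ y → 3 * (1 * (y * y + y * y) + y * y) ≡ 9 * (y * y)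
    eq₂ = solve-∀
    eq₃ : ∀ T → 9 * suc (8 * T) ≡ 2 * suc (2 * (18 * T)) + 7
    eq₃ = solve-∀
  diagonal t (inj₂ h) = even≢odd (3 * T) n (ℕ.*-cancelˡ-≡ _ _ 4 (ℕ.+-cancelʳ-≡ (3 + 3 * suc (8 * T)) _ _
    (trans (eq₁ T) (trans (cong (6 *_) (sym (odd-square t))) (trans (eq₂ (odd t)) (trans h (trans (cong (λ u → 8 * n + 7 + 3 * u) (odd-square t)) (eq₃ n T))))))))
    where
    T = triangle t
    eq₁ : ∀ T → 4 * (2 * (3 * T)) + (3 + 3 * suc (8 * T)) ≡ 6 * suc (8 * T)
    eq₁ = solve-∀
    eq₂ : ∀ y → 6 * (y * y) ≡ 3 * (1 * (y * y + y * y))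
    eq₂ = solve-∀
    eq₃ : ∀ n T → 8 * n + 7 + 3 * suc (8 * T) ≡ 4 * suc (2 * n) + (3 + 3 * suc (8 * T))
    eq₃ = solve-∀

-- `M` is an odd exponent of f_1 ψ(q⁵). Tripled, it leads to T_i + 15T_t = 3M, hence d = 2 and K =
-- 3M + 2.
module ΘΨ₅ (k : ℕ) where

  private
    M = suc (2 * k)

    eq : ∀ M → 2 * (3 * M) + 2 * 2 * 1 ≡ 2 * (3 * M + 2)
    eq = solve-∀

  open Lattice 2 1 15 (3 * M + 2) (3 * M) refl (eq M) public

  private
    -- K = 3M + 2 is odd because `M` is, whereas 2y² ± yw + 2w² is even for even w.
    even-unrelated : ∀ y v → ¬ Related y (2 * v)
    even-unrelated y v (inj₁ h) = even≢odd (y * y + 2 * v * (2 * v) + y * v) (2 + 3 * k) (trans (eq₁ y v) (trans h (eq₂ k)))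
      where
      eq₁ : ∀ y v → 2 * (y * y + 2 * v * (2 * v) + y * v) ≡ 1 * (2 * (y * y + 2 * v * (2 * v)) + y * (2 * v))
      eq₁ = solve-∀
      eq₂ : ∀ k → 3 * suc (2 * k) + 2 ≡ suc (2 * (2 + 3 * k))
      eq₂ = solve-∀
    even-unrelated y v (inj₂ h) = even≢odd (y * y + 2 * v * (2 * v)) (2 + 3 * k + y * v) (trans (sym (ℕ.*-identityˡ _)) (trans h (eq₂ k y v)))
      where
      eq₂ : ∀ k y v → 3 * suc (2 * k) + 2 + 1 * (y * (2 * v)) ≡ suc (2 * (2 + 3 * k + y * v))
      eq₂ = solve-∀

    odd-link : ∀ i t w → Solution i t → Link 2 i t w → ∃[ j ] Link 2 i t (odd j)
    odd-link i t w sol link with parity w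
    ... | v , inj₁ refl = contradiction (link⇒related i t (2 * v) link sol) (even-unrelated (odd t) v)
    ... | v , inj₂ refl = v , link

    -- Whichever of |i - t| and i + t + 1 is even is 2w; `odd-link` excludes an even w.
    linked : ∀ i t → Solution i t → ∃[ j ] Link 2 i t (odd j)
    linked i t sol with parity (i + t)
    ... | k , inj₂ h = odd-link i t (suc k) sol (cross (trans (cong suc h) (sym (ℕ.*-suc 2 k))))
    ... | k , inj₁ h with difference-even i t k h
    ...   | j , inj₁ h′ = odd-link i t j sol (plus h′)
    ...   | j , inj₂ h′ = odd-link i t j sol (minus h′)

  -- At w = y the plus sign gives 5y² = 3M + 2 = 6k + 5 with y² = 8T + 1. The minus sign gives 3y² =
  -- 3M + 2, impossible modulo 3.
  related-diagonal : ∀ t → Related (odd t) (odd t) → 5 * (8 * triangle t) ≡ 6 * k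
  related-diagonal t (inj₁ h) = ℕ.+-cancelʳ-≡ 5 _ _
    (trans (eq₁ T) (trans (cong (5 *_) (sym (odd-square t))) (trans (eq₂ (odd t)) (trans h (eq₃ k)))))
    where
    T = triangle t
    eq₁ : ∀ T → 5 * (8 * T) + 5 ≡ 5 * suc (8 * T)
    eq₁ = solve-∀
    eq₂ : ∀ y → 5 * (y * y) ≡ 1 * (2 * (y * y + y * y) + y * y)
    eq₂ = solve-∀
    eq₃ : ∀ k → 3 * suc (2 * k) + 2 ≡ 6 * k + 5
    eq₃ = solve-∀
  related-diagonal t (inj₂ h) = contradiction
    (∣m+n∣m⇒∣n (subst (3 ∣_) y²-equation (m∣m*n (odd t * odd t))) (m∣m*n M)) (>⇒∤ (s≤s (s≤s (s≤s z≤n))))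
    where
    eq₁ : ∀ u → 3 * u + u ≡ 1 * (2 * (u + u))
    eq₁ = solve-∀
    y²-equation : 3 * (odd t * odd t) ≡ 3 * M + 2
    y²-equation = ℕ.+-cancelʳ-≡ (odd t * odd t) _ _ (trans (eq₁ (odd t * odd t)) (trans h (cong (3 * M + 2 +_) (ℕ.*-identityˡ _))))

  diagonal-related : ∀ t → 5 * (8 * triangle t) ≡ 6 * k → Related (odd t) (odd t)
  diagonal-related t h = inj₁ (trans (eq₁ (odd t)) (trans (cong (5 *_) (odd-square t)) (trans (eq₂ T) (trans (cong (_+ 5) h) (eq₃ k)))))
    where
    T = triangle t
    eq₁ : ∀ y → 1 * (2 * (y * y + y * y) + y * y) ≡ 5 * (y * y)
    eq₁ = solve-∀
    eq₂ : ∀ T → 5 * suc (8 * T) ≡ 5 * (8 * T) + 5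
    eq₂ = solve-∀
    eq₃ : ∀ k → 6 * k + 5 ≡ 3 * suc (2 * k) + 2
    eq₃ = solve-∀

  ΘΨ₅-diagonal : ∀ {a b} → 3 * M < a → 2 * (3 * M) < b →
    𝔽₂.Σ< b (λ t → 𝔽₂.Σ< a (λ i → 1 * (triangle i + 15 * triangle t) ≡ᵇ 3 * M))
      ≡ 𝔽₂.Σ< b (λ t → 5 * (8 * triangle t) ≡ᵇ 6 * k)
  ΘΨ₅-diagonal {a} {b} m<a 2m<b = trans (Σ-solutions linked m<a 2m<b)
    (𝔽₂.Σ-cong b (λ t _ → does-⇔ (mk⇔ (related-diagonal t) (diagonal-related t)) (related? (odd t) (odd t)) (_ ℕ.≟ _)))

-- Splitting the triangular numbers by their index modulo 3 gives three times the pentagonal numbers,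
-- and the numbers 1 + 9 triangle s, which are never divisible by 3.
Σ-triangle-pent : ∀ a b m n →
  𝔽₂.Σ< (3 * n) (λ i → suc (3 * a) * triangle i + 3 * b ≡ᵇ 3 * m)
    ≡ 𝔽₂.Σ< n (λ s → (suc (3 * a) * pent⁺ s + b ≡ᵇ m) xor (suc (3 * a) * pent⁻ s + b ≡ᵇ m))
Σ-triangle-pent a b m n = trans (𝔽₂.Σ-mod3 n _) (𝔽₂.Σ-cong n (λ s _ → cong₂ _xor_
  (trans (cong₂ _xor_ (third (pent⁺ s) (triangle-3n s)) (≡ᵇ-false (middle s))) (xor-identityʳ (suc (3 * a) * pent⁺ s + b ≡ᵇ m))) (third (pent⁻ s) (triangle-2+3n s))))
  where
  eq₁ : ∀ a b p → suc (3 * a) * (3 * p) + 3 * b ≡ 3 * (suc (3 * a) * p + b)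
  eq₁ = solve-∀
  third : ∀ {T} p → T ≡ 3 * p → (suc (3 * a) * T + 3 * b ≡ᵇ 3 * m) ≡ (suc (3 * a) * p + b ≡ᵇ m)
  third p refl = ≡ᵇ-cong {k = suc (3 * a) * p + b} {m} (λ h → ℕ.*-cancelˡ-≡ _ _ 3 (trans (sym (eq₁ a b p)) h)) (λ h → trans (eq₁ a b p) (cong (3 *_) h))
  eq₂ : ∀ a b T → suc (3 * a) * (1 + 9 * T) + 3 * b ≡ 3 * (suc (3 * a) * (3 * T) + a + b) + 1
  eq₂ = solve-∀
  -- A coefficient that is 1 modulo 3 keeps these values 1 modulo 3. The coefficients in use are 1
  -- and 10.
  middle : ∀ s → suc (3 * a) * triangle (1 + 3 * s) + 3 * b ≢ 3 * m
  middle s h = contradiction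
    (∣m+n∣m⇒∣n (subst (3 ∣_) (trans (sym h) (trans (cong (λ T → suc (3 * a) * T + 3 * b) (triangle-1+3n s)) (eq₂ a b (triangle s)))) (m∣m*n m))
      (m∣m*n (suc (3 * a) * (3 * triangle s) + a + b)))
    (>⇒∤ (s≤s (s≤s z≤n)))

-- Halved, the equation is 20T = 6n + 3, with sides of different parity.
ΘΨ₅-parity-3 : ∀ n b →
  𝔽₂.Σ< b (λ t → 5 * (8 * triangle t) ≡ᵇ 6 * suc (2 * n)) ≡ false
ΘΨ₅-parity-3 n b = 𝔽₂.Σ-zero b (λ t _ → ≡ᵇ-false λ h →
  even≢odd (10 * triangle t) (1 + 3 * n) (ℕ.*-cancelˡ-≡ _ _ 2 (trans (eq₁ (triangle t)) (trans h (eq₂ n)))))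
  where
  eq₁ : ∀ T → 2 * (2 * (10 * T)) ≡ 5 * (8 * T)
  eq₁ = solve-∀
  eq₂ : ∀ n → 6 * suc (2 * n) ≡ 2 * suc (2 * (1 + 3 * n))
  eq₂ = solve-∀

-- The equation is 10T = 3n, so T is three times a pentagonal number p and 10p = n: these are the
-- exponents of f_10.
ΘΨ₅-parity-1 : ∀ n {b} → 3 * n < b →
  𝔽₂.Σ< b (λ t → 5 * (8 * triangle t) ≡ᵇ 6 * (2 * n))
    ≡ 𝔽₂.Σ< b (λ s → (10 * pent⁺ s ≡ᵇ n) xor (10 * pent⁻ s ≡ᵇ n))
ΘΨ₅-parity-1 n {b} 3n<b = begin
  𝔽₂.Σ< b (λ t → 5 * (8 * triangle t) ≡ᵇ 6 * (2 * n))
    ≡⟨ 𝔽₂.Σ-cong b (λ t _ → ≡ᵇ-cong {k = 10 * triangle t + 3 * 0} {3 * n}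
         (λ h → ℕ.*-cancelˡ-≡ _ _ 4 (trans (eq₁ (triangle t)) (trans h (eq₂ n))))
         (λ h → trans (sym (eq₁ (triangle t))) (trans (cong (4 *_) h) (sym (eq₂ n))))) ⟩
  𝔽₂.Σ< b (λ t → 10 * triangle t + 3 * 0 ≡ᵇ 3 * n)
    ≡⟨ 𝔽₂.Σ-truncate (λ t → 10 * triangle t + 3 * 0 ≡ᵇ 3 * n) (ℕ.m≤n*m b 3) (λ t b≤t → ≡ᵇ-false (ℕ.<⇒≢ (large t b≤t) ∘ sym)) ⟨
  𝔽₂.Σ< (3 * b) (λ t → 10 * triangle t + 3 * 0 ≡ᵇ 3 * n)
    ≡⟨ Σ-triangle-pent 3 0 n b ⟩
  𝔽₂.Σ< b (λ s → (10 * pent⁺ s + 0 ≡ᵇ n) xor (10 * pent⁻ s + 0 ≡ᵇ n))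
    ≡⟨ 𝔽₂.Σ-cong b (λ s _ → cong₂ (λ u v → (u ≡ᵇ n) xor (v ≡ᵇ n)) (ℕ.+-identityʳ (10 * pent⁺ s)) (ℕ.+-identityʳ (10 * pent⁻ s))) ⟩
  𝔽₂.Σ< b (λ s → (10 * pent⁺ s ≡ᵇ n) xor (10 * pent⁻ s ≡ᵇ n)) ∎
  where
  open ≡.≡-Reasoning
  eq₁ : ∀ T → 4 * (10 * T + 3 * 0) ≡ 5 * (8 * T)
  eq₁ = solve-∀
  eq₂ : ∀ n → 6 * (2 * n) ≡ 4 * (3 * n)
  eq₂ = solve-∀
  large : ∀ t → b ≤ t → 3 * n < 10 * triangle t + 3 * 0
  large t b≤t = ℕ.<-≤-trans 3n<b (ℕ.≤-trans b≤t (ℕ.≤-trans (n≤triangle t) (ℕ.≤-trans (ℕ.m≤n*m (triangle t) 10) (ℕ.m≤m+n _ 0))))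

-- Partitions and Euler products as power series

open import Data.Integer as ℤ using (+_; -[1+_]; ∣_∣; _⊖_; _-_)

odd? : ℕ → Bool
odd? zero = false
odd? (suc n) = not (odd? n)

odd?-+ : ∀ m n → odd? (m + n) ≡ odd? m xor odd? n
odd?-+ zero n = refl
odd?-+ (suc m) n = trans (cong not (odd?-+ m n)) (not-distribˡ-xor (odd? m) (odd? n))

odd?-false⇒2∣ : ∀ n → odd? n ≡ false → 2 ∣ n
odd?-false⇒2∣ zero _ = divides 0 refl
odd?-false⇒2∣ (suc (suc n)) h with odd?-false⇒2∣ n (trans (sym (not-involutive (odd? n))) h)
... | divides k refl = divides (suc k) refl

odd?-⊖ : ∀ m n → odd? ∣ m ⊖ n ∣ ≡ odd? m xor odd? n
odd?-⊖ zero zero = refl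
odd?-⊖ zero (suc n) = refl
odd?-⊖ (suc m) zero = sym (xor-identityʳ (not (odd? m)))
odd?-⊖ (suc m) (suc n) = trans (cong (odd? ∘ ∣_∣) (ℤ.[1+m]⊖[1+n]≡m⊖n m n))
  (trans (odd?-⊖ m n) (sym (xor-annihilates-not (odd? m) (odd? n))))

odd?-∣+∣ : ∀ i j → odd? ∣ i ℤ.+ j ∣ ≡ odd? ∣ i ∣ xor odd? ∣ j ∣
odd?-∣+∣ (+ m) (+ n) = odd?-+ m n
odd?-∣+∣ (+ m) -[1+ n ] = odd?-⊖ m (suc n)
odd?-∣+∣ -[1+ m ] (+ n) = trans (odd?-⊖ n (suc m)) (xor-comm (odd? n) (not (odd? m)))
odd?-∣+∣ -[1+ m ] -[1+ n ] = trans (cong (not ∘ not) (odd?-+ m n)) (trans (cong not (not-distribˡ-xor (odd? m) (odd? n))) (not-distribʳ-xor (not (odd? m)) (odd? n)))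

odd?-∣-∣ : ∀ i j → odd? ∣ i ℤ.- j ∣ ≡ odd? ∣ i ∣ xor odd? ∣ j ∣
odd?-∣-∣ i j = trans (odd?-∣+∣ i (ℤ.- j)) (cong (λ k → odd? ∣ i ∣ xor odd? k) (ℤ.∣-i∣≡∣i∣ j))

-- Parity of the number of restricted partitions

countParity : ∀ {A : Set} {P : Pred A 0ℓ} → Decidable P → List A → Bool
countParity P? = odd? ∘ length ∘ filter P?

countParity-∷ : ∀ {A : Set} {P : Pred A 0ℓ} (P? : Decidable P) x xs →
  countParity P? (x ∷ xs) ≡ does (P? x) xor countParity P? xs
countParity-∷ P? x xs with does (P? x)
... | true = refl
... | false = refl

countParity-++ : ∀ {A : Set} {P : Pred A 0ℓ} (P? : Decidable P) xs ys →
  countParity P? (xs ++ ys) ≡ countParity P? xs xor countParity P? ys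
countParity-++ P? xs ys = trans (cong odd? (trans (cong length (filter-++ P? xs ys)) (length-++ (filter P? xs)))) (odd?-+ (length (filter P? xs)) _)

-- General `g` because the induction shifts it; `upTo` is the case of the identity.
countParity-concatMap : ∀ {A : Set} {P : Pred A 0ℓ} (P? : Decidable P) {Q : Pred ℕ 0ℓ} (Q? : Decidable Q) (f : ℕ → List A) (g : ℕ → ℕ) n →
  countParity P? (concatMap f (filter Q? (applyUpTo g n))) ≡ 𝔽₂.Σ< n (λ j → does (Q? (g j)) ∧ countParity P? (f (g j)))
countParity-concatMap P? Q? f g zero = refl
countParity-concatMap P? Q? f g (suc n) = trans step (sym (𝔽₂.Σ-head n _))
  where
  rest = countParity-concatMap P? Q? f (g ∘ suc) n
  step : countParity P? (concatMap f (filter Q? (applyUpTo g (suc n)))) ≡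
    (does (Q? (g 0)) ∧ countParity P? (f (g 0))) xor 𝔽₂.Σ< n (λ j → does (Q? (g (suc j))) ∧ countParity P? (f (g (suc j))))
  step with does (Q? (g 0))
  ... | false = rest
  ... | true = trans (countParity-++ P? (f (g 0)) _) (cong (countParity P? (f (g 0)) xor_) rest)

-- `b` will say whether the multiplicity of the new largest part is admissible, which is the same
-- for all `xs`.
countParity-map : ∀ {A B : Set} {P : Pred B 0ℓ} (P? : Decidable P) {Q : Pred A 0ℓ} (Q? : Decidable Q) (f : A → B) b {xs} →
  All (λ x → does (P? (f x)) ≡ b ∧ does (Q? x)) xs → countParity P? (map f xs) ≡ b ∧ countParity Q? xs
countParity-map P? Q? f false [] = refl
countParity-map P? Q? f true [] = refl
countParity-map P? Q? f b {x ∷ xs} (h ∷ hs) = trans (countParity-∷ P? (f x) (map f xs))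
  (trans (cong₂ _xor_ h (countParity-map P? Q? f b hs)) (trans (distrib b) (cong (b ∧_) (sym (countParity-∷ Q? x xs)))))
  where
  distrib : ∀ b → (b ∧ does (Q? x)) xor (b ∧ countParity Q? xs) ≡ b ∧ (does (Q? x) xor countParity Q? xs)
  distrib true = refl
  distrib false = refl

-- Makes the next part `suc k` differ from all the others, so its copies leave their multiplicities
-- alone.
parts-bounded : ∀ k n → All (All (_≤ k)) (parts k n)
parts-bounded zero zero = [] ∷ []
parts-bounded zero (suc n) = []
parts-bounded (suc k) n = All.concat⁺ (All.map⁺ (All.universal (λ j → All.map⁺ (All.map
  (λ l≤k → All.++⁺ (All.replicate⁺ j ℕ.≤-refl) (All.map ℕ.m≤n⇒m≤1+n l≤k)) (parts-bounded k (n ∸ j * suc k))))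
  (filter (λ j → j * suc k ≤? n) (upTo (suc n)))))

occ-++ : ∀ a l l′ → occ a (l ++ l′) ≡ occ a l + occ a l′
occ-++ a l l′ = trans (cong length (filter-++ (ℕ._≟ a) l l′)) (length-++ (filter (ℕ._≟ a) l))

occ-replicate : ∀ a j → occ a (replicate j a) ≡ j
occ-replicate a zero = refl
occ-replicate a (suc j) = trans (cong length (filter-accept (ℕ._≟ a) refl)) (cong suc (occ-replicate a j))

occ-replicate-≢ : ∀ {a b} j → b ≢ a → occ a (replicate j b) ≡ 0
occ-replicate-≢ zero b≢a = refl
occ-replicate-≢ {a} (suc j) b≢a = trans (cong length (filter-reject (ℕ._≟ a) b≢a)) (occ-replicate-≢ j b≢a)

occ-absent : ∀ {a l} → All (_≢ a) l → occ a l ≡ 0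
occ-absent [] = refl
occ-absent {a} (b≢a ∷ h) = trans (cong length (filter-reject (ℕ._≟ a) b≢a)) (occ-absent h)

module _ (s t : ℕ) (0<t : 0 < t) where

  private
    occ-old : ∀ {m l a} j → All (_< m) l → a < m → occ a (replicate j m ++ l) ≡ occ a l
    occ-old {m} {l} {a} j l<m a<m = trans (occ-++ a (replicate j m) l) (cong (_+ occ a l) (occ-replicate-≢ j (ℕ.<⇒≢ a<m ∘ sym)))

    occ-new : ∀ {m l} j → All (_< m) l → occ m (replicate j m ++ l) ≡ j
    occ-new {m} {l} j l<m = trans (occ-++ m (replicate j m) l)
      (trans (cong₂ _+_ (occ-replicate m j) (occ-absent (All.map ℕ.<⇒≢ l<m))) (ℕ.+-identityʳ j))

    j<bound : ∀ {m} j → (¬ s ∣ m) × j < t → j < multiplicityBound s t m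
    j<bound {m} j (s∤m , j<t) with s ∣? m
    ... | yes s∣m = contradiction s∣m s∤m
    ... | no _ = j<t

    j<bound⁻ : ∀ {m} j → suc j < multiplicityBound s t m → (¬ s ∣ m) × suc j < t
    j<bound⁻ {m} j h with s ∣? m
    ... | yes _ = contradiction h λ { (s≤s ()) }
    ... | no s∤m = s∤m , h

    0<bound : ∀ m → 0 < multiplicityBound s t m
    0<bound m with s ∣? m
    ... | yes _ = s≤s z≤n
    ... | no _ = 0<t

  -- `m` is new, so its multiplicity is exactly `j` and the conditions on `m` and on `l` separate.
  -- For `j = 0` the bound always holds, even if `s` divides `m`.
  IsRD-replicate : ∀ {m l} j → All (_< m) l → IsRD s t (replicate j m ++ l) ⇔ (j < multiplicityBound s t m × IsRD s t l)
  IsRD-replicate {m} {l} j l<m = mk⇔ (to j) (from j)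
    where
    -- `l′` runs through the parts to be tested, while occurrences are always counted in the fixed
    -- `l`.
    old⁻ : ∀ j {l′} → All (_< m) l′ → All (λ a → occ a (replicate j m ++ l) < t) l′ → All (λ a → occ a l < t) l′
    old⁻ j [] [] = []
    old⁻ j (a<m ∷ h) (p ∷ ps) = subst (_< t) (occ-old j l<m a<m) p ∷ old⁻ j h ps

    old⁺ : ∀ j {l′} → All (_< m) l′ → All (λ a → occ a l < t) l′ → All (λ a → occ a (replicate j m ++ l) < t) l′
    old⁺ j [] [] = []
    old⁺ j (a<m ∷ h) (p ∷ ps) = subst (_< t) (sym (occ-old j l<m a<m)) p ∷ old⁺ j h ps

    to : ∀ j → IsRD s t (replicate j m ++ l) → j < multiplicityBound s t m × IsRD s t l
    to zero h = 0<bound m , h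
    to (suc j) (r@(s∤m ∷ _) , o@(j<t ∷ _)) = j<bound (suc j) (s∤m , subst (_< t) (occ-new (suc j) l<m) j<t)
      , All.++⁻ʳ (replicate (suc j) m) r , old⁻ (suc j) l<m (All.++⁻ʳ (replicate (suc j) m) o)

    from : ∀ j → j < multiplicityBound s t m × IsRD s t l → IsRD s t (replicate j m ++ l)
    from zero (_ , h) = h
    from (suc j) (h , r , o) with j<bound⁻ j h
    ... | s∤m , j<t = All.++⁺ (All.replicate⁺ (suc j) s∤m) r
      , All.++⁺ (All.replicate⁺ (suc j) (subst (_< t) (sym (occ-new (suc j) l<m)) j<t)) (old⁺ (suc j) l<m o)

  countParity-parts-suc : ∀ k n → countParity (isRD? s t) (parts (suc k) n) ≡
    𝔽₂.Σ< (suc n) (λ j → does (j * suc k ≤? n) ∧ does (j <? multiplicityBound s t (suc k)) ∧ countParity (isRD? s t) (parts k (n ∸ j * suc k)))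
  countParity-parts-suc k n = trans
    (countParity-concatMap (isRD? s t) (λ j → j * suc k ≤? n) (λ j → map (replicate j (suc k) ++_) (parts k (n ∸ j * suc k))) id (suc n))
    (𝔽₂.Σ-cong (suc n) (λ j _ → cong (does (j * suc k ≤? n) ∧_)
      (countParity-map (isRD? s t) (isRD? s t) (replicate j (suc k) ++_) (does (j <? multiplicityBound s t (suc k)))
        (All.map (λ l≤k → does-⇔ (IsRD-replicate j (All.map s≤s l≤k)) (isRD? s t _) (j <? multiplicityBound s t (suc k) ×-dec isRD? s t _)) (parts-bounded k (n ∸ j * suc k))))))

shift-≤ : ∀ k f n → shift k f n ≡ does (k ≤? n) ∧ f (n ∸ k)
shift-≤ zero f n = refl
shift-≤ (suc k) f zero = refl
shift-≤ (suc k) f (suc n) = trans (shift-≤ k f n) (cong (_∧ f (n ∸ k)) (does-⇔ (mk⇔ s≤s ℕ.≤-pred) (k ≤? n) (suc k ≤? suc n)))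

shift-> : ∀ {k f n} → n < k → shift k f n ≡ false
shift-> {k} {f} {n} n<k = trans (shift-≤ k f n) (cong (_∧ f (n ∸ k)) (dec-false (k ≤? n) (ℕ.<⇒≱ n<k)))

module Coefficients (N : ℕ) where
  open Truncated N public
  private module R = CommutativeRing (truncatedRing N)

  ⊛-q^ : ∀ f k n → (f ⊛ q ^ k) n ≡ shift k f n
  ⊛-q^ f k n = trans (⊛-comm f (q ^ k) n) (q^-⊛ N k f n)

  partitionProd-parity : ∀ s t → 0 < t → ∀ k n → n ≤ N → countParity (isRD? s t) (parts k n) ≡ partitionProd s t q k n
  partitionProd-parity s t 0<t zero zero _ = refl
  partitionProd-parity s t 0<t zero (suc n) _ = refl
  partitionProd-parity s t 0<t (suc k) n n≤N = begin
    countParity (isRD? s t) (parts (suc k) n)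
      ≡⟨ countParity-parts-suc s t 0<t k n ⟩
    𝔽₂.Σ< (suc n) term
      -- The list lets j run up to `n`, the product up to `b`; the range `suc n + b` contains both,
      -- and the extra terms vanish.
      ≡⟨ 𝔽₂.Σ-truncate term (ℕ.m≤m+n (suc n) b) (λ j n<j → cong (_∧ rest j) (dec-false (j * suc k ≤? n) (ℕ.<⇒≱ (ℕ.<-≤-trans n<j (ℕ.m≤m*n j (suc k)))))) ⟨
    𝔽₂.Σ< (suc n + b) term
      ≡⟨ 𝔽₂.Σ-truncate term (ℕ.m≤n+m b (suc n)) (λ j b≤j → trans (cong (λ u → does (j * suc k ≤? n) ∧ u ∧ c j) (dec-false (j <? b) (ℕ.≤⇒≯ b≤j))) (∧-zeroʳ _)) ⟩
    𝔽₂.Σ< b term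
      ≡⟨ 𝔽₂.Σ-cong b (λ j j<b → trans (cong (λ u → does (j * suc k ≤? n) ∧ u ∧ c j) (dec-true (j <? b) j<b)) (coefficient j)) ⟩
    𝔽₂.Σ< b (λ j → (partitionProd s t q k ⊛ (q ^ suc k) ^ j) n)
      ≡⟨ Σ-coeff N b _ n ⟨
    Σ< b (λ j → partitionProd s t q k ⊛ (q ^ suc k) ^ j) n
      ≡⟨ coeff (Σ-*ˡ b (partitionProd s t q k) ((q ^ suc k) ^_)) n n≤N ⟨
    partitionProd s t q (suc k) n ∎
    where
    open ≡.≡-Reasoning
    b = multiplicityBound s t (suc k)
    c : ℕ → Bool
    c j = countParity (isRD? s t) (parts k (n ∸ j * suc k))
    rest : ℕ → Bool
    rest j = does (j <? b) ∧ c j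
    term : ℕ → Bool
    term j = does (j * suc k ≤? n) ∧ rest j
    coefficient : ∀ j → does (j * suc k ≤? n) ∧ c j ≡ (partitionProd s t q k ⊛ (q ^ suc k) ^ j) n
    coefficient j = begin
      does (j * suc k ≤? n) ∧ c j
        ≡⟨ cong (does (j * suc k ≤? n) ∧_) (partitionProd-parity s t 0<t k (n ∸ j * suc k) (ℕ.≤-trans (ℕ.m∸n≤m n (j * suc k)) n≤N)) ⟩
      does (j * suc k ≤? n) ∧ partitionProd s t q k (n ∸ j * suc k)
        ≡⟨ shift-≤ (j * suc k) _ n ⟨
      shift (j * suc k) (partitionProd s t q k) n
        ≡⟨ ⊛-q^ (partitionProd s t q k) (j * suc k) n ⟨
      (partitionProd s t q k ⊛ q ^ (j * suc k)) n
        ≡⟨ coeff (R.*-congˡ (R.trans (^-exp q (ℕ.*-comm j (suc k))) (R.sym (^-assocʳ q (suc k) j)))) n n≤N ⟩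
      (partitionProd s t q k ⊛ (q ^ suc k) ^ j) n ∎

  eulerProd-suc-coeff : ∀ k M n → n ≤ N →
    eulerProd (q ^ k) (suc M) n ≡ eulerProd (q ^ k) M n xor shift (k * suc M) (eulerProd (q ^ k) M) n
  eulerProd-suc-coeff k M n n≤N = trans
    (coeff (R.trans (R.distribˡ E 𝟙 _) (R.+-cong (R.*-identityʳ E) (R.*-congˡ (^-assocʳ q k (suc M))))) n n≤N)
    (cong (E n xor_) (⊛-q^ E (k * suc M) n))
    where E = eulerProd (q ^ k) M

  prod5-parity : ∀ M n → n ≤ N → odd? ∣ prod5 M n ∣ ≡ eulerProd (q ^ 5) M n
  prod5-parity zero zero _ = refl
  prod5-parity zero (suc n) _ = refl
  prod5-parity (suc M) n n≤N = trans step (sym (eulerProd-suc-coeff 5 M n n≤N))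
    where
    E = eulerProd (q ^ 5) M
    step : odd? ∣ prod5 (suc M) n ∣ ≡ E n xor shift (5 * suc M) E n
    step with 5 * suc M ≤? n
    ... | yes h = trans (odd?-∣-∣ (prod5 M n) (prod5 M (n ∸ 5 * suc M)))
      (cong₂ _xor_ (prod5-parity M n n≤N) (trans (prod5-parity M (n ∸ 5 * suc M) (ℕ.≤-trans (ℕ.m∸n≤m n (5 * suc M)) n≤N))
        (sym (trans (shift-≤ (5 * suc M) E n) (cong (_∧ E (n ∸ 5 * suc M)) (dec-true (5 * suc M ≤? n) h))))))
    ... | no h = trans (prod5-parity M n n≤N) (sym (trans (cong (E n xor_) (shift-> {f = E} (ℕ.≰⇒> h))) (xor-identityʳ _)))

  -- A factor after the first `n` affects only degrees above `n`. This links the `n` factors of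
  -- `euler5Coeff n` to the `N` factors used elsewhere.
  eulerProd-coeff-stable : ∀ k d n → n ≤ N → eulerProd (q ^ suc k) (d + n) n ≡ eulerProd (q ^ suc k) n n
  eulerProd-coeff-stable k zero n n≤N = refl
  eulerProd-coeff-stable k (suc d) n n≤N = begin
    eulerProd (q ^ suc k) (suc (d + n)) n
      ≡⟨ eulerProd-suc-coeff (suc k) (d + n) n n≤N ⟩
    E n xor shift (suc k * suc (d + n)) E n
      ≡⟨ cong (E n xor_) (shift-> {f = E} (ℕ.<-≤-trans (s≤s (ℕ.m≤n+m n d)) (ℕ.m≤n*m (suc (d + n)) (suc k)))) ⟩
    E n xor false
      ≡⟨ xor-identityʳ _ ⟩
    E n
      ≡⟨ eulerProd-coeff-stable k d n n≤N ⟩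
    eulerProd (q ^ suc k) n n ∎
    where
    open ≡.≡-Reasoning
    E = eulerProd (q ^ suc k) (d + n)

  Σ-*-coeff : ∀ b (F G : ℕ → 𝔽₂⟦q⟧) n → n ≤ N →
    (Σ< b F ⊛ Σ< b G) n ≡ 𝔽₂.Σ< b (λ t → 𝔽₂.Σ< b (λ i → (F i ⊛ G t) n))
  Σ-*-coeff b F G n n≤N = begin
    (Σ< b F ⊛ Σ< b G) n
      ≡⟨ coeff (Σ-*ˡ b (Σ< b F) G) n n≤N ⟩
    Σ< b (λ t → Σ< b F ⊛ G t) n
      ≡⟨ Σ-coeff N b _ n ⟩
    𝔽₂.Σ< b (λ t → (Σ< b F ⊛ G t) n)
      ≡⟨ 𝔽₂.Σ-cong b (λ t _ → trans (coeff (Σ-*ʳ b (G t) F) n n≤N) (Σ-coeff N b _ n)) ⟩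
    𝔽₂.Σ< b (λ t → 𝔽₂.Σ< b (λ i → (F i ⊛ G t) n)) ∎
    where open ≡.≡-Reasoning

  q^-*-coeff : ∀ k l n → n ≤ N → (q ^ k ⊛ q ^ l) n ≡ (k + l ≡ᵇ n)
  q^-*-coeff k l n n≤N = trans (coeff (R.sym (^-homo-* q k l)) n n≤N) (q^-coeff N (k + l) n)

  [q^k]^l-coeff : ∀ k l n → n ≤ N → ((q ^ k) ^ l) n ≡ (k * l ≡ᵇ n)
  [q^k]^l-coeff k l n n≤N = trans (coeff (^-assocʳ q k l) n n≤N) (q^-coeff N (k * l) n)

  Θ-coeff : ∀ k b n → n ≤ N → Θ (q ^ k) b n ≡ 𝔽₂.Σ< b (λ s → (k * pent⁺ s ≡ᵇ n) xor (k * pent⁻ s ≡ᵇ n))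
  Θ-coeff k b n n≤N = trans (Σ-coeff N b _ n)
    (𝔽₂.Σ-cong b (λ s _ → cong₂ _xor_ ([q^k]^l-coeff k (pent⁺ s) n n≤N) ([q^k]^l-coeff k (pent⁻ s) n n≤N)))

  Ψ*Ψ-coeff : ∀ k l b n → n ≤ N →
    (Ψ (q ^ k) b ⊛ Ψ (q ^ l) b) n ≡ 𝔽₂.Σ< b (λ t → 𝔽₂.Σ< b (λ i → k * triangle i + l * triangle t ≡ᵇ n))
  Ψ*Ψ-coeff k l b n n≤N = trans (Σ-*-coeff b _ _ n n≤N) (𝔽₂.Σ-cong b (λ t _ → 𝔽₂.Σ-cong b (λ i _ →
    trans (coeff (R.*-cong (^-assocʳ q k (triangle i)) (^-assocʳ q l (triangle t))) n n≤N) (q^-*-coeff (k * triangle i) (l * triangle t) n n≤N))))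

  Θ*Ψ-coeff : ∀ l b n → n ≤ N →
    (Θ q b ⊛ Ψ (q ^ l) b) n ≡ 𝔽₂.Σ< b (λ t → 𝔽₂.Σ< b (λ s → (pent⁺ s + l * triangle t ≡ᵇ n) xor (pent⁻ s + l * triangle t ≡ᵇ n)))
  Θ*Ψ-coeff l b n n≤N = trans (Σ-*-coeff b _ _ n n≤N) (𝔽₂.Σ-cong b (λ t _ → 𝔽₂.Σ-cong b (λ s _ → trans
    (coeff (R.trans (R.*-congˡ (^-assocʳ q l (triangle t))) (R.distribʳ (q ^ (l * triangle t)) (q ^ pent⁺ s) (q ^ pent⁻ s))) n n≤N)
    (cong₂ _xor_ (q^-*-coeff (pent⁺ s) (l * triangle t) n n≤N) (q^-*-coeff (pent⁻ s) (l * triangle t) n n≤N)))))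

-- The three congruences

⊛-zeroʳ : ∀ f {g} n → (∀ i → i ≤ n → g i ≡ false) → (f ⊛ g) n ≡ false
⊛-zeroʳ f {g} n e = trans (⊛-cong n (λ _ _ → refl) e) (trans (⊛-comm f 𝟘 n) (⊛-zeroˡ f n))

odd?-pRD-3-3-4n+2 : ∀ n → odd? (pRD 3 3 (4 * n + 2)) ≡ false
odd?-pRD-3-3-4n+2 n = trans (partitionProd-parity 3 3 (s≤s z≤n) N N ℕ.≤-refl)
  (trans (cong G (index n)) (⊛-cancelˡ-zero f (section 1 (section 0 G)) n
    (cong₂ _∧_ (eulerProd-constant N q N refl) (eulerProd-constant N (q ^ 9) N refl)) vanish))
  where
  N = 4 * n + 2
  b = suc (2 * N)
  open Coefficients N
  G = partitionProd 3 3 q N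
  f = eulerProd q N ⊛ eulerProd (q ^ 9) N
  index : ∀ n → 4 * n + 2 ≡ (n * 2 + 1) * 2 + 0
  index = solve-∀
  dissection = partitionProd-3-3 (ℕ.m≤n⇒m≤o+n (4 * n) (s≤s z≤n)) (q-vanishing N) {b} (ℕ.n≤1+n (2 * N))
  g = proj₁ dissection
  -- Removes the term g²q from the even exponents.
  section-q : ∀ i → section 0 q i ≡ false
  section-q zero = refl
  section-q (suc i) = refl
  vanish : ∀ i → i ≤ n → (f ⊛ section 1 (section 0 G)) i ≡ false
  vanish i i≤n = begin
    (f ⊛ section 1 (section 0 G)) i
      ≡⟨ section-fourth 0 1 (s≤s z≤n) (s≤s (s≤s z≤n)) f G i ⟨
    (f ⊛ f ⊛ (f ⊛ f) ⊛ G) ((i * 2 + 1) * 2 + 0)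
      ≡⟨ coeff (proj₂ dissection) _ small ⟩
    (g ⊛ g ⊛ q) ((i * 2 + 1) * 2 + 0) xor (Ψ (q ^ 3) b ⊛ Ψ (q ^ 9) b) ((i * 2 + 1) * 2 + 0)
      ≡⟨ cong₂ _xor_ (trans (section-square 0 (s≤s z≤n) g q (i * 2 + 1)) (⊛-zeroʳ g (i * 2 + 1) (λ j _ → section-q j)))
           (trans (Ψ*Ψ-coeff 3 9 b _ small) (trans reindex (Ψ₃Ψ₉-parity i (s≤s (ℕ.*-monoʳ-≤ 2 (ℕ.+-monoˡ-≤ 2 (ℕ.*-monoʳ-≤ 4 i≤n))))))) ⟩
    false ∎
    where
    open ≡.≡-Reasoning
    small : (i * 2 + 1) * 2 + 0 ≤ N
    small = ℕ.≤-trans (ℕ.≤-reflexive (sym (index i))) (ℕ.+-monoˡ-≤ 2 (ℕ.*-monoʳ-≤ 4 i≤n))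
    eq : ∀ u v → 3 * u + 9 * v ≡ 3 * (u + 3 * v)
    eq = solve-∀
    reindex = 𝔽₂.Σ-cong b (λ t _ → 𝔽₂.Σ-cong b (λ j _ → cong₂ _≡ᵇ_ (eq (triangle j) (triangle t)) (sym (index i))))

module Dissection₂₅ (N : ℕ) (1≤N : 1 ≤ N) where
  open Coefficients N
  -- Exceeds 2m for every tripled exponent m = 3M with M ≤ N, as the lattice count requires.
  b = suc (6 * N)
  G = partitionProd 2 5 q N
  e₁ = eulerProd q N
  e₅ = eulerProd (q ^ 5) N
  f = e₁ ⊛ e₅
  P = Θ q b ⊛ Ψ (q ^ 5) b

  f-constant : f 0 ≡ true
  f-constant = cong₂ _∧_ (eulerProd-constant N q N refl) (eulerProd-constant N (q ^ 5) N refl)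

  dissection : ∀ r i → r < 2 → (i * 2 + r) * 2 + 1 ≤ N → (f ⊛ section r (section 1 G)) i ≡ (e₁ ⊛ section r (section 1 P)) i
  dissection r i r<2 small = begin
    (f ⊛ section r (section 1 G)) i              ≡⟨ section-fourth 1 r (s≤s (s≤s z≤n)) r<2 f G i ⟨
    (f ⊛ f ⊛ (f ⊛ f) ⊛ G) ((i * 2 + r) * 2 + 1)  ≡⟨ coeff (partitionProd-2-5 1≤N (q-vanishing N) {b} (ℕ.m≤n⇒m≤1+n (ℕ.*-monoˡ-≤ N (s≤s (s≤s (z≤n {4})))))) _ small ⟩
    (e₁ ⊛ e₁ ⊛ (e₁ ⊛ e₁) ⊛ P) ((i * 2 + r) * 2 + 1) ≡⟨ section-fourth 1 r (s≤s (s≤s z≤n)) r<2 e₁ P i ⟩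
    (e₁ ⊛ section r (section 1 P)) i             ∎
    where open ≡.≡-Reasoning

  -- The pentagonal sum over `b` indices becomes a triangular sum over `3 * b` indices at the
  -- tripled exponent, where the symmetry in y and w applies.
  P-coeff : ∀ k → suc (2 * k) ≤ N → P (suc (2 * k)) ≡ 𝔽₂.Σ< b (λ t → 5 * (8 * triangle t) ≡ᵇ 6 * k)
  P-coeff k M≤N = begin
    P M
      ≡⟨ Θ*Ψ-coeff 5 b M M≤N ⟩
    𝔽₂.Σ< b (λ t → 𝔽₂.Σ< b (λ s → (pent⁺ s + 5 * triangle t ≡ᵇ M) xor (pent⁻ s + 5 * triangle t ≡ᵇ M)))
      ≡⟨ 𝔽₂.Σ-cong b (λ t _ → sym (row t)) ⟩
    𝔽₂.Σ< b (λ t → 𝔽₂.Σ< (3 * b) (λ i → 1 * (triangle i + 15 * triangle t) ≡ᵇ 3 * M))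
      ≡⟨ ΘΨ₅.ΘΨ₅-diagonal k (ℕ.*-monoʳ-< 3 (ℕ.≤-<-trans M≤N (s≤s (ℕ.m≤n*m N 6)))) (s≤s (ℕ.≤-trans (ℕ.≤-reflexive (sym (ℕ.*-assoc 2 3 M))) (ℕ.*-monoʳ-≤ 6 M≤N))) ⟩
    𝔽₂.Σ< b (λ t → 5 * (8 * triangle t) ≡ᵇ 6 * k) ∎
    where
    open ≡.≡-Reasoning
    M = suc (2 * k)
    eq : ∀ u v → 1 * (u + 15 * v) ≡ 1 * u + 3 * (5 * v)
    eq = solve-∀
    row : ∀ t → 𝔽₂.Σ< (3 * b) (λ i → 1 * (triangle i + 15 * triangle t) ≡ᵇ 3 * M)
      ≡ 𝔽₂.Σ< b (λ s → (pent⁺ s + 5 * triangle t ≡ᵇ M) xor (pent⁻ s + 5 * triangle t ≡ᵇ M))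
    row t = trans (𝔽₂.Σ-cong (3 * b) (λ i _ → cong (_≡ᵇ 3 * M) (eq (triangle i) (triangle t))))
      (trans (Σ-triangle-pent 0 (5 * triangle t) M b)
        (𝔽₂.Σ-cong b (λ s _ → cong₂ (λ u v → (u + 5 * triangle t ≡ᵇ M) xor (v + 5 * triangle t ≡ᵇ M)) (ℕ.*-identityˡ (pent⁺ s)) (ℕ.*-identityˡ (pent⁻ s)))))

odd?-pRD-2-5-4n+3 : ∀ n → odd? (pRD 2 5 (4 * n + 3)) ≡ false
odd?-pRD-2-5-4n+3 n = trans (partitionProd-parity 2 5 (s≤s z≤n) N N ℕ.≤-refl)
  (trans (cong G (index n)) (⊛-cancelˡ-zero f (section 1 (section 1 G)) n f-constant λ i i≤n →
    trans (dissection 1 i (s≤s (s≤s z≤n)) (small i i≤n)) (⊛-zeroʳ e₁ i (λ j j≤i → vanish j (ℕ.≤-trans j≤i i≤n)))))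
  where
  N = 4 * n + 3
  open Coefficients N using (partitionProd-parity)
  open Dissection₂₅ N (ℕ.m≤n⇒m≤o+n (4 * n) (s≤s z≤n))
  index : ∀ n → 4 * n + 3 ≡ (n * 2 + 1) * 2 + 1
  index = solve-∀
  index′ : ∀ n → (n * 2 + 1) * 2 + 1 ≡ suc (2 * suc (2 * n))
  index′ = solve-∀
  small : ∀ i → i ≤ n → (i * 2 + 1) * 2 + 1 ≤ N
  small i i≤n = ℕ.≤-trans (ℕ.≤-reflexive (sym (index i))) (ℕ.+-monoˡ-≤ 3 (ℕ.*-monoʳ-≤ 4 i≤n))
  vanish : ∀ i → i ≤ n → section 1 (section 1 P) i ≡ false
  vanish i i≤n = trans (cong P (index′ i)) (trans (P-coeff (suc (2 * i)) (subst (_≤ N) (index′ i) (small i i≤n))) (ΘΨ₅-parity-3 i b))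

odd?-pRD-2-5-4n+1 : ∀ n → odd? (pRD 2 5 (4 * n + 1)) ≡ odd? ∣ euler5Coeff n ∣
odd?-pRD-2-5-4n+1 n = begin
  odd? (pRD 2 5 (4 * n + 1))
    ≡⟨ partitionProd-parity 2 5 (s≤s z≤n) N N ℕ.≤-refl ⟩
  G (4 * n + 1)
    ≡⟨ cong G (index n) ⟩
  section 0 (section 1 G) n
    -- By `square` the section of `P` is e₅², so f times the section of `G` is e₁ e₅² = f e₅, and f
    -- cancels.
    ≡⟨ ⊛-cancelˡ f (section 0 (section 1 G)) e₅ n f-constant (λ i i≤n →
         trans (dissection 0 i (s≤s z≤n) (small i i≤n))
           (trans (⊛-cong i (λ _ _ → refl) (λ j j≤i → square j (ℕ.≤-trans j≤i i≤n))) (sym (⊛-assoc e₁ e₅ e₅ i)))) ⟩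
  eulerProd (q ^ 5) (4 * n + 1) n
    ≡⟨ cong (λ M → eulerProd (q ^ 5) M n) (split n) ⟩
  eulerProd (q ^ 5) (3 * n + 1 + n) n
    ≡⟨ eulerProd-coeff-stable 4 (3 * n + 1) n n≤N ⟩
  eulerProd (q ^ 5) n n
    ≡⟨ prod5-parity n n n≤N ⟨
  odd? ∣ euler5Coeff n ∣ ∎
  where
  open ≡.≡-Reasoning
  N = 4 * n + 1
  open Coefficients N
  open Dissection₂₅ N (ℕ.m≤n+m 1 (4 * n))
  index : ∀ n → 4 * n + 1 ≡ (n * 2 + 0) * 2 + 1
  index = solve-∀
  index′ : ∀ n → (n * 2 + 0) * 2 + 1 ≡ suc (2 * (2 * n))
  index′ = solve-∀
  split : ∀ n → 4 * n + 1 ≡ 3 * n + 1 + n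
  split = solve-∀
  n≤N : n ≤ N
  n≤N = subst (n ≤_) (sym (split n)) (ℕ.m≤n+m n (3 * n + 1))
  small : ∀ i → i ≤ n → (i * 2 + 0) * 2 + 1 ≤ N
  small i i≤n = ℕ.≤-trans (ℕ.≤-reflexive (sym (index i))) (ℕ.+-monoˡ-≤ 1 (ℕ.*-monoʳ-≤ 4 i≤n))
  3i<b : ∀ i → i ≤ n → 3 * i < b
  3i<b i i≤n = s≤s (ℕ.*-mono-≤ (s≤s (s≤s (s≤s (z≤n {3})))) (ℕ.≤-trans i≤n n≤N))
  square : ∀ i → i ≤ n → section 0 (section 1 P) i ≡ (e₅ ⊛ e₅) i
  square i i≤n = begin
    section 0 (section 1 P) i
      ≡⟨ cong P (index′ i) ⟩
    P (suc (2 * (2 * i)))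
      ≡⟨ P-coeff (2 * i) (subst (_≤ N) (index′ i) (small i i≤n)) ⟩
    𝔽₂.Σ< b (λ t → 5 * (8 * triangle t) ≡ᵇ 6 * (2 * i))
      ≡⟨ ΘΨ₅-parity-1 i (3i<b i i≤n) ⟩
    𝔽₂.Σ< b (λ s → (10 * pent⁺ s ≡ᵇ i) xor (10 * pent⁻ s ≡ᵇ i))
      ≡⟨ Θ-coeff 10 b i (ℕ.≤-trans i≤n n≤N) ⟨
    Θ (q ^ 10) b i
      ≡⟨ coeff (eulerProd-square-pentagonal (ℕ.m≤n+m 1 (4 * n)) (q-vanishing N) 4 (ℕ.m≤n⇒m≤1+n (ℕ.m≤n*m N 6))) i (ℕ.≤-trans i≤n n≤N) ⟨
    (e₅ ⊛ e₅) i ∎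

theorem4 : (∀ (n : ℕ) → 2 ∣ pRD 3 3 (4 * n + 2))
    × (∀ (n : ℕ) → 2 ∣ pRD 2 5 (4 * n + 3))
    × (∀ (n : ℕ) → (ℤD._∣_ (+ 2) (+ pRD 2 5 (4 * n + 1) - euler5Coeff n)))
theorem4 = (λ n → odd?-false⇒2∣ _ (odd?-pRD-3-3-4n+2 n))
  , (λ n → odd?-false⇒2∣ _ (odd?-pRD-2-5-4n+3 n))
  , (λ n → odd?-false⇒2∣ _ (trans (odd?-∣-∣ (+ pRD 2 5 (4 * n + 1)) (euler5Coeff n))
      (trans (cong (_xor odd? ∣ euler5Coeff n ∣) (odd?-pRD-2-5-4n+1 n)) (xor-same (odd? ∣ euler5Coeff n ∣)))))
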